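{- There exist constants $0<c_1<c_2$ such that for all integers $d\ge 2$, \[ \frac{1}{2}+\frac{c_1}{\sqrt{d}}\le \gamma_{2,d}\le \frac{1}{2}+\frac{c_2}{\sqrt{d}}. \]
   Context: For integers $k\ge 2$ and $n\ge 1$ let $[k]=\{1,\dots,k\}$. A subsequence of a string is obtained by deleting zero or more of its characters. For strings $X^1,\dots,X^d$, $\mathrm{LCS}(X^1,\dots,X^d)$ denotes the length of a longest string that is a subsequence of every $X^i$. The generalized Chvátal–Sankoff constant is \[ \gamma_{k,d}=\lim_{n\to\infty}\frac{\mathbb{E}[\mathrm{LCS}(X^1,\dots,X^d)]}{n}, \] where $X^1,\dots,X^d$ are independent uniformly random strings in $[k]^n$ (this limit exists). -}

module Defs where

open import Data.Nat as ℕ using (ℕ; zero; suc; _^_; _⊔_)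
open import Data.Nat.Properties using (m^n≢0; m*n≢0)
open import Data.Fin using (Fin)
open import Data.Fin.Properties using (_≟_)
open import Data.List using (List; []; _∷_; map; concatMap; length; foldr; allFin)
open import Data.List.Relation.Unary.All using (all?)
open import Data.Nat.ListAction using (sum)
open import Data.Integer using (+_)
open import Data.Rational using (ℚ; _/_; 0ℚ; ½; _+_; _-_; _*_; _<_; _≤_)
open import Data.Product using (_×_)
open import Data.Sum using (_⊎_)
open import Relation.Nullary using (yes; no)

strings : (k n : ℕ) → List (List (Fin k))
strings k zero    = [] ∷ []
strings k (suc n) = concatMap (λ w → map (λ a → a ∷ w) (allFin k)) (strings k n)

stringsUpTo : (k n : ℕ) → List (List (Fin k))
stringsUpTo k zero    = strings k zero
stringsUpTo k (suc n) = strings k (suc n) Data.List.++ stringsUpTo k n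

tuples : (k n d : ℕ) → List (List (List (Fin k)))
tuples k n zero    = [] ∷ []
tuples k n (suc d) = concatMap (λ t → map (λ x → x ∷ t) (strings k n)) (tuples k n d)

-- LCS(X¹,…,Xᵈ) for strings of length n: the largest length of a string that is a
-- subsequence (Sublist, i.e. obtained by deleting characters) of every Xⁱ.
-- Every common subsequence has length ≤ n (for d ≥ 1), so it suffices to
-- range over strings of length ≤ n.
module _ {k : ℕ} where
  open import Data.List.Relation.Binary.Sublist.DecPropositional (_≟_ {n = k}) using (_⊆?_)

  LCS : (n : ℕ) → List (List (Fin k)) → ℕ
  LCS n Xs = foldr step 0 (stringsUpTo k n)
    where
    step : List (Fin k) → ℕ → ℕ
    step w m with all? (w ⊆?_) Xs
    ... | yes _ = length w ⊔ m
    ... | no  _ = m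

-- E[LCS(X¹,…,Xᵈ)] / n for independent uniform X¹,…,Xᵈ ∈ [k]^n, as a rational:
-- (Σ over all k^(n·d) tuples of LCS) / (n · k^(n·d)).  Only used for k ≥ 1, n ≥ 1.
lcsRate : (k d n : ℕ) → ℚ
lcsRate zero    d n       = 0ℚ
lcsRate k       d zero    = 0ℚ
lcsRate (suc k) d (suc n) =
  (+ sum (map (LCS (suc n)) (tuples (suc k) (suc n) d)))
    / (suc n ℕ.* (suc k ^ (suc n ℕ.* d)))
    where instance _ = m*n≢0 (suc n) (suc k ^ (suc n ℕ.* d)) {{_}} {{m^n≢0 (suc k) (suc n ℕ.* d)}}

-- For a rational x, c > 0 and d ≥ 1 (√d irrational in general, so squared out):
-- x > 1/2 + c/√d   ⟺   x > 1/2  and  c² < (x − 1/2)²·d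
GtHalfPlus : ℚ → ℚ → ℕ → Set
GtHalfPlus x c d = (½ < x) × (c * c < ((x - ½) * (x - ½)) * (+ d / 1))

-- x < 1/2 + c/√d   ⟺   x ≤ 1/2  or  (x − 1/2)²·d < c²        (for c > 0)
LtHalfPlus : ℚ → ℚ → ℕ → Set
LtHalfPlus x c d = (x ≤ ½) ⊎ (((x - ½) * (x - ½)) * (+ d / 1) < c * c)

-- γ_{k,d} = lim_n lcsRate k d n (the limit exists).  For a limit L of a sequence aₙ:
-- t ≤ L  ⟺  ∀ ε > 0, ∃ N, ∀ n ≥ N, aₙ + ε > t.
-- L ≤ t  ⟺  ∀ ε > 0, ∃ N, ∀ n ≥ N, aₙ − ε < t.
open import Data.Product using (∃-syntax)

HalfPlusLeGamma : (k d : ℕ) → ℚ → Set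
HalfPlusLeGamma k d c =
  ∀ (ε : ℚ) → 0ℚ < ε → ∃[ N ] ∀ n → N ℕ.≤ n → GtHalfPlus (lcsRate k d n + ε) c d

GammaLeHalfPlus : (k d : ℕ) → ℚ → Set
GammaLeHalfPlus k d c =
  ∀ (ε : ℚ) → 0ℚ < ε → ∃[ N ] ∀ n → N ℕ.≤ n → LtHalfPlus (lcsRate k d n - ε) c d

{-# OPTIONS --safe #-}

-- Upper bound: a fixed word w is a subsequence of a random string of length n with probability at
-- most αⁿ r^|w| for every r ≤ 1, where α r ≥ (1 + r)/2.  With r = 1 - Θ(1/√d) the d-th power of this
-- beats the union bound over all 2ⁿ⁺¹ words as soon as |w| ≥ n/2 + Cn/√d.
--
-- Lower bound: build a common subsequence greedily.  Look at the d next letters, choose a letter b by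
-- majority, and advance every string behind its next b.  A string whose next letter is b consumes 1
-- letter, the others 3 on average.  For a threshold majority, a given string agrees with b with
-- probability 1/2 + ℙ(tie among the others)/2 = 1/2 + Θ(1/√d), so a round consumes 2 - Θ(1/√d) letters
-- per string on average.  An exponential moment of the number of letters consumed, summed over the
-- strings, bounds the probability that m rounds do not fit.
module Submission where

open import Defs
open import Algebra.Bundles using (CommutativeRing)
open import Data.Bool using (Bool; true; false; if_then_else_)
open import Data.Empty using (⊥-elim)
open import Data.Fin as Fin using (Fin)
import Data.Fin.Properties as FinP
open import Data.Integer as ℤ using (+_; +≤+)
import Data.Integer.Properties as ℤP
import Data.Integer.Tactic.RingSolver as ℤSolver
open import Data.List as List using (List; []; _∷_; length; concatMap; allFin)
import Data.List.Properties as ListP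
open import Data.List.Relation.Unary.All as All using (All; []; _∷_)
import Data.List.Relation.Unary.All.Properties as AllP
open import Data.List.Relation.Binary.Sublist.Propositional using (_⊆_; []; _∷_; _∷ʳ_; minimum)
open import Data.List.Relation.Binary.Sublist.Heterogeneous.Properties using (∷⁻; ∷ʳ⁻)
open import Data.List.Membership.Propositional using (_∈_)
open import Data.List.Membership.Propositional.Properties using (∈-++⁺ˡ; ∈-++⁺ʳ; ∈-map⁺; ∈-concatMap⁺; ∈-allFin)
open import Data.List.Relation.Unary.Any as Any using (here; there)
open import Data.Nat as ℕ using (ℕ; zero; suc; z≤n; s≤s)
open import Data.Nat.Combinatorics using (nCk+nC[k+1]≡[n+1]C[k+1]; nCk≡nC[n∸k]; nCn≡1; nC1≡n) renaming (_C_ to binomial)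
import Data.Nat.Coprimality as Coprimality
import Data.Nat.DivMod as DivMod
open import Data.Nat.ListAction using (sum)
import Data.Nat.ListAction.Properties as SumP
import Data.Nat.Properties as ℕP
import Data.Nat.Tactic.RingSolver as ℕSolver
open import Data.Product using (_×_; _,_; ∃-syntax; proj₁; proj₂)
open import Data.Rational using (ℚ; mkℚ; _/_; 0ℚ; 1ℚ; ½; _+_; _-_; _*_; -_; _<_; _≤_; *≤*; *<*; toℚᵘ; nonNegative; positive)
open import Data.Rational.Properties
import Data.Rational.Unnormalised as ℚᵘ
import Data.Rational.Unnormalised.Properties as ℚᵘP
open import Data.Sum using (_⊎_; inj₁; inj₂)
open import Data.Vec as Vec using (Vec; []; _∷_)
import Data.Vec.Relation.Unary.All as VAll
open import Function using (_∘_)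
open import Relation.Nullary using (¬_; Dec; yes; no; does)
open import Relation.Nullary.Decidable using (dec⇒maybe; toWitness)
open import Relation.Binary.PropositionalEquality using (_≡_; refl; sym; trans; cong; cong₂; subst; subst₂; module ≡-Reasoning)
open import Tactic.RingSolver using (solve-∀)
open import Tactic.RingSolver.Core.AlmostCommutativeRing using (AlmostCommutativeRing; fromCommutativeRing)
open import Algebra.Properties.Semiring.Exp (CommutativeRing.semiring +-*-commutativeRing) using (_^_; ^-homo-*; ^-assocʳ)
open import Algebra.Properties.CommutativeSemiring.Exp (CommutativeRing.commutativeSemiring +-*-commutativeRing) using (^-distrib-*)
open import Data.List.Relation.Binary.Sublist.DecPropositional (FinP._≟_ {n = 2}) using (_⊆?_)

-- All estimates are rational: an integer `h` with h² ≤ d ≤ 4h² stands for √d, Bernoulli's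
-- inequality stands for the exponential function, and `e` is of order 1/h. Both bounds hold for
-- `lcsRate` itself at every large n, so no limit has to be formed. In the greedy procedure all
-- strings depend on each other through the common letter b. The potential, the sum of r^(letters
-- left) over the strings, is linear, so only the marginal cost of a single string matters. In both
-- directions the terms of first order in `e` cancel around the value 1/2, and the argument lives at
-- second order. In the lower bound a round costs a surplus of order e² from the fluctuation of the
-- waiting times, while a tie of probability p gains about p e; hence `e` has to be a small multiple
-- of p, that is, of 1/√d. In the upper bound α² r = 1 + O(e²), and the d-th power of the error
-- stays bounded by a constant per letter because d e² is bounded.

ℚ-ring : AlmostCommutativeRing _ _
ℚ-ring = fromCommutativeRing +-*-commutativeRing (λ p → dec⇒maybe (0ℚ ≟ p))

-- Natural numbers inside the rationals, and order lemmas

2ℚ 4ℚ 8ℚ : ℚ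
2ℚ = + 2 / 1
4ℚ = + 4 / 1
8ℚ = + 8 / 1

ι : ℕ → ℚ
ι n = mkℚ (+ n) 0 (Coprimality.sym (Coprimality.1-coprimeTo n))

/1≡ι : ∀ n → + n / 1 ≡ ι n
/1≡ι n = ↥p/↧p≡p (ι n)

ι-+ : ∀ m n → ι (m ℕ.+ n) ≡ ι m + ι n
ι-+ m n = toℚᵘ-injective (ℚᵘP.≃-sym (ℚᵘP.≃-trans (toℚᵘ-homo-+ (ι m) (ι n))
                                                  (ℚᵘ.*≡* (lemma (+ m) (+ n)))))
  where
  lemma : ∀ a b → (a ℤ.* + 1 ℤ.+ b ℤ.* + 1) ℤ.* + 1 ≡ (a ℤ.+ b) ℤ.* + 1
  lemma = ℤSolver.solve-∀

ι-* : ∀ m n → ι (m ℕ.* n) ≡ ι m * ι n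
ι-* m n = toℚᵘ-injective (ℚᵘP.≃-sym (ℚᵘP.≃-trans (toℚᵘ-homo-* (ι m) (ι n))
                                                  (ℚᵘ.*≡* (cong (ℤ._* + 1) (sym (ℤP.pos-* m n))))))

ι-^ : ∀ m n → ι (m ℕ.^ n) ≡ ι m ^ n
ι-^ m zero    = refl
ι-^ m (suc n) = trans (ι-* m (m ℕ.^ n)) (cong (ι m *_) (ι-^ m n))

ι-mono-≤ : ∀ {m n} → m ℕ.≤ n → ι m ≤ ι n
ι-mono-≤ m≤n = *≤* (ℤP.*-monoʳ-≤-nonNeg (+ 1) (+≤+ m≤n))

0≤ι : ∀ n → 0ℚ ≤ ι n
0≤ι n = ι-mono-≤ {0} {n} z≤n

0<ι : ∀ n .{{_ : ℕ.NonZero n}} → 0ℚ < ι n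
0<ι (suc n) = *<* (ℤ.+<+ (s≤s z≤n))

/-*-ι : ∀ m n .{{_ : ℕ.NonZero n}} → (+ m / n) * ι n ≡ ι m
/-*-ι m n@(suc n-1) = toℚᵘ-injective (ℚᵘP.≃-trans (toℚᵘ-homo-* (+ m / n) (ι n))
  (ℚᵘP.≃-trans (ℚᵘP.*-congʳ {toℚᵘ (ι n)} (toℚᵘ-fromℚᵘ (ℚᵘ.mkℚᵘ (+ m) n-1)))
               (ℚᵘ.*≡* (trans (ℤP.*-identityʳ _) (cong (+ m ℤ.*_) (cong +_ (sym (ℕP.*-identityʳ n))))))))

-- The certificate for polynomial inequalities: the slack `s` is written in a visibly nonnegative
-- form, and the remaining equation is left to the ring solver.
≤-by : ∀ {p q} s → 0ℚ ≤ s → p + s ≡ q → p ≤ q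
≤-by {p} {q} s 0≤s eq = subst₂ _≤_ (+-identityʳ p) eq (+-monoʳ-≤ p 0≤s)

≤⇒0≤- : ∀ {p q} → p ≤ q → 0ℚ ≤ q - p
≤⇒0≤- {p} {q} p≤q = subst (_≤ q - p) (+-inverseʳ p) (+-monoˡ-≤ (- p) p≤q)

*-monoˡ : ∀ {p q} c → 0ℚ ≤ c → p ≤ q → c * p ≤ c * q
*-monoˡ c 0≤c = *-monoˡ-≤-nonNeg c {{nonNegative 0≤c}}

*-monoʳ : ∀ {p q} c → 0ℚ ≤ c → p ≤ q → p * c ≤ q * c
*-monoʳ c 0≤c = *-monoʳ-≤-nonNeg c {{nonNegative 0≤c}}

0≤* : ∀ {p q} → 0ℚ ≤ p → 0ℚ ≤ q → 0ℚ ≤ p * q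
0≤* {p} {q} 0≤p 0≤q = subst (_≤ p * q) (*-zeroʳ p) (*-monoˡ p 0≤p 0≤q)

0≤+ : ∀ {p q} → 0ℚ ≤ p → 0ℚ ≤ q → 0ℚ ≤ p + q
0≤+ = +-mono-≤

*-mono : ∀ {p q r s} → 0ℚ ≤ p → 0ℚ ≤ s → p ≤ q → r ≤ s → p * r ≤ q * s
*-mono 0≤p 0≤s p≤q r≤s = ≤-trans (*-monoˡ _ 0≤p r≤s) (*-monoʳ _ 0≤s p≤q)

*-cancelʳ-≤ : ∀ {r p q} → 0ℚ < r → p * r ≤ q * r → p ≤ q
*-cancelʳ-≤ {r} 0<r = *-cancelʳ-≤-pos r {{positive 0<r}}

*-cancelʳ-≡ : ∀ {r p q} → 0ℚ < r → p * r ≡ q * r → p ≡ q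
*-cancelʳ-≡ 0<r eq = ≤-antisym (*-cancelʳ-≤ 0<r (≤-reflexive eq)) (*-cancelʳ-≤ 0<r (≤-reflexive (sym eq)))

-- Powers and Bernoulli's inequality

0≤1 : 0ℚ ≤ 1ℚ
0≤1 = 0≤ι 1

0≤^ : ∀ {p} n → 0ℚ ≤ p → 0ℚ ≤ p ^ n
0≤^ zero    0≤p = 0≤1
0≤^ (suc n) 0≤p = 0≤* 0≤p (0≤^ n 0≤p)

^-monoˡ-≤ : ∀ {p q} n → 0ℚ ≤ p → p ≤ q → p ^ n ≤ q ^ n
^-monoˡ-≤ zero    0≤p p≤q = ≤-refl
^-monoˡ-≤ (suc n) 0≤p p≤q = *-mono 0≤p (0≤^ n (≤-trans 0≤p p≤q)) p≤q (^-monoˡ-≤ n 0≤p p≤q)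

1^n≡1 : ∀ n → 1ℚ ^ n ≡ 1ℚ
1^n≡1 zero    = refl
1^n≡1 (suc n) = trans (*-identityˡ _) (1^n≡1 n)

^-≤1 : ∀ {p} n → 0ℚ ≤ p → p ≤ 1ℚ → p ^ n ≤ 1ℚ
^-≤1 {p} n 0≤p p≤1 = subst (p ^ n ≤_) (1^n≡1 n) (^-monoˡ-≤ n 0≤p p≤1)

1≤^ : ∀ {p} n → 1ℚ ≤ p → 1ℚ ≤ p ^ n
1≤^ {p} n 1≤p = subst (_≤ p ^ n) (1^n≡1 n) (^-monoˡ-≤ n 0≤1 1≤p)

^-antitoneʳ : ∀ {p m n} → 0ℚ ≤ p → p ≤ 1ℚ → m ℕ.≤ n → p ^ n ≤ p ^ m
^-antitoneʳ {p} {m} 0≤p p≤1 m≤n with ℕP.m≤n⇒∃[o]m+o≡n m≤n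
... | k , refl = begin
  p ^ (m ℕ.+ k)    ≡⟨ ^-homo-* p m k ⟩
  p ^ m * p ^ k    ≤⟨ *-monoˡ (p ^ m) (0≤^ m 0≤p) (^-≤1 k 0≤p p≤1) ⟩
  p ^ m * 1ℚ       ≡⟨ *-identityʳ _ ⟩
  p ^ m            ∎
  where open ≤-Reasoning

bernoulli : ∀ n y → 0ℚ ≤ 1ℚ + y → 0ℚ ≤ y * y → 1ℚ + ι n * y ≤ (1ℚ + y) ^ n
bernoulli zero    y 0≤1+y 0≤y² = ≤-reflexive (cong (_+_ 1ℚ) (*-zeroˡ y))
bernoulli (suc n) y 0≤1+y 0≤y² = begin
  1ℚ + ι (suc n) * y            ≡⟨ cong (λ z → 1ℚ + z * y) (ι-+ 1 n) ⟩
  1ℚ + (1ℚ + ι n) * y           ≤⟨ ≤-by (ι n * (y * y)) (0≤* (0≤ι n) 0≤y²) (identity (ι n) y) ⟩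
  (1ℚ + y) * (1ℚ + ι n * y)     ≤⟨ *-monoˡ (1ℚ + y) 0≤1+y (bernoulli n y 0≤1+y 0≤y²) ⟩
  (1ℚ + y) * (1ℚ + y) ^ n       ∎
  where
  open ≤-Reasoning
  identity : ∀ m y → 1ℚ + (1ℚ + m) * y + m * (y * y) ≡ (1ℚ + y) * (1ℚ + m * y)
  identity = solve-∀ ℚ-ring

bernoulli⁺ : ∀ n {y} → 0ℚ ≤ y → 1ℚ + ι n * y ≤ (1ℚ + y) ^ n
bernoulli⁺ n {y} 0≤y = bernoulli n y (0≤+ 0≤1 0≤y) (0≤* 0≤y 0≤y)

bernoulli⁻ : ∀ n {y} → 0ℚ ≤ y → y ≤ 1ℚ → 1ℚ - ι n * y ≤ (1ℚ - y) ^ n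
bernoulli⁻ n {y} 0≤y y≤1 = subst (_≤ (1ℚ - y) ^ n) (cong (_+_ 1ℚ) (sym (neg-distribʳ-* (ι n) y)))
  (bernoulli n (- y) (≤⇒0≤- y≤1) (subst (0ℚ ≤_) (identity y) (0≤* 0≤y 0≤y)))
  where
  identity : ∀ y → y * y ≡ (- y) * (- y)
  identity = solve-∀ ℚ-ring

[1-y]^n*[1+y]^n≤1 : ∀ n {y} → 0ℚ ≤ y → y ≤ 1ℚ → (1ℚ - y) ^ n * (1ℚ + y) ^ n ≤ 1ℚ
[1-y]^n*[1+y]^n≤1 n {y} 0≤y y≤1 = begin
  (1ℚ - y) ^ n * (1ℚ + y) ^ n     ≡⟨ ^-distrib-* (1ℚ - y) (1ℚ + y) n ⟨
  ((1ℚ - y) * (1ℚ + y)) ^ n       ≤⟨ ^-≤1 n (0≤* (≤⇒0≤- y≤1) (0≤+ 0≤1 0≤y))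
                                            (≤-by (y * y) (0≤* 0≤y 0≤y) (identity y)) ⟩
  1ℚ                              ∎
  where
  open ≤-Reasoning
  identity : ∀ y → (1ℚ - y) * (1ℚ + y) + y * y ≡ 1ℚ
  identity = solve-∀ ℚ-ring

-- The substitute for exponential decay, (1 - y)^n ≤ 1/(1 + n y). It follows from (1 - y)(1 + y) ≤ 1
-- and Bernoulli for 1 + y. The decay is only of order 1/(n y), but raising it to a further power
-- restores an exponential rate.
inverse-bernoulli : ∀ n {y} → 0ℚ ≤ y → y ≤ 1ℚ → (1ℚ - y) ^ n * (1ℚ + ι n * y) ≤ 1ℚ
inverse-bernoulli n {y} 0≤y y≤1 = ≤-trans (*-monoˡ _ (0≤^ n (≤⇒0≤- y≤1)) (bernoulli⁺ n 0≤y))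
                                          ([1-y]^n*[1+y]^n≤1 n 0≤y y≤1)

²-cancel-≤ : ∀ {p q} → 0ℚ ≤ q → p * p ≤ q * q → p ≤ q
²-cancel-≤ {p} {q} 0≤q p²≤q² = ≮⇒≥ λ q<p → <-irrefl refl (begin-strict
  p * p   ≤⟨ p²≤q² ⟩
  q * q   ≤⟨ *-monoˡ q 0≤q (<⇒≤ q<p) ⟩
  q * p   <⟨ *-monoˡ-<-pos p {{positive (≤-<-trans 0≤q q<p)}} q<p ⟩
  p * p   ∎)
  where open ≤-Reasoning

-- Probability measures, represented by their expectation functionals

record Mean (A : Set) : Set₁ where
  field
    𝔼       : (A → ℚ) → ℚ
    𝔼-mono  : ∀ {f g} → (∀ a → f a ≤ g a) → 𝔼 f ≤ 𝔼 g
    𝔼-+     : ∀ f g → 𝔼 (λ a → f a + g a) ≡ 𝔼 f + 𝔼 g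
    𝔼-*     : ∀ c f → 𝔼 (λ a → c * f a) ≡ c * 𝔼 f
    𝔼-const : ∀ c → 𝔼 (λ _ → c) ≡ c

  -- Monotonicity in both directions takes the place of function extensionality.
  𝔼-cong : ∀ {f g} → (∀ a → f a ≡ g a) → 𝔼 f ≡ 𝔼 g
  𝔼-cong f≗g = ≤-antisym (𝔼-mono (≤-reflexive ∘ f≗g)) (𝔼-mono (≤-reflexive ∘ sym ∘ f≗g))

  𝔼-*ʳ : ∀ f c → 𝔼 (λ a → f a * c) ≡ 𝔼 f * c
  𝔼-*ʳ f c = trans (𝔼-cong (λ a → *-comm (f a) c)) (trans (𝔼-* c f) (*-comm c (𝔼 f)))

open Mean

return : ∀ {A} → A → Mean A
return a = record
  { 𝔼 = λ f → f a ; 𝔼-mono = λ f≤g → f≤g a ; 𝔼-+ = λ _ _ → refl ; 𝔼-* = λ _ _ → refl ; 𝔼-const = λ _ → refl }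

bind : ∀ {A B} → Mean A → (A → Mean B) → Mean B
bind m k = record
  { 𝔼       = λ f → 𝔼 m (λ a → 𝔼 (k a) f)
  ; 𝔼-mono  = λ f≤g → 𝔼-mono m (λ a → 𝔼-mono (k a) f≤g)
  ; 𝔼-+     = λ f g → trans (𝔼-cong m (λ a → 𝔼-+ (k a) f g)) (𝔼-+ m _ _)
  ; 𝔼-*     = λ c f → trans (𝔼-cong m (λ a → 𝔼-* (k a) c f)) (𝔼-* m c _)
  ; 𝔼-const = λ c → trans (𝔼-cong m (λ a → 𝔼-const (k a) c)) (𝔼-const m c)
  }

push : ∀ {A B} → (A → B) → Mean A → Mean B
push h m = record
  { 𝔼       = λ f → 𝔼 m (f ∘ h)
  ; 𝔼-mono  = λ f≤g → 𝔼-mono m (f≤g ∘ h)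
  ; 𝔼-+     = λ f g → 𝔼-+ m (f ∘ h) (g ∘ h)
  ; 𝔼-*     = λ c f → 𝔼-* m c (f ∘ h)
  ; 𝔼-const = 𝔼-const m
  }

Bit Str : Set
Bit = Fin 2
Str = List Bit

pattern 0b = Fin.zero
pattern 1b = Fin.suc Fin.zero

average : ∀ {p q r s} → p ≤ q → r ≤ s → ½ * (p + r) ≤ ½ * (q + s)
average p≤q r≤s = *-monoˡ ½ (toWitness {a? = 0ℚ ≤? ½} _) (+-mono-≤ p≤q r≤s)

coin : Mean Bit
coin = record
  { 𝔼       = λ f → ½ * (f 0b + f 1b)
  ; 𝔼-mono  = λ f≤g → average (f≤g 0b) (f≤g 1b)
  ; 𝔼-+     = λ f g → add (f 0b) (f 1b) (g 0b) (g 1b)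
  ; 𝔼-*     = λ c f → scale c (f 0b) (f 1b)
  ; 𝔼-const = half
  }
  where
  add : ∀ a b c d → ½ * (a + c + (b + d)) ≡ ½ * (a + b) + ½ * (c + d)
  add = solve-∀ ℚ-ring
  scale : ∀ c a b → ½ * (c * a + c * b) ≡ c * (½ * (a + b))
  scale = solve-∀ ℚ-ring
  half : ∀ a → ½ * (a + a) ≡ a
  half = solve-∀ ℚ-ring

-- The nesting is that of `strings`, the new letter being drawn innermost, so that sums over the
-- list become expectations by the same recursion. The opposite order, first letter outermost, is
-- `word-head`.
word : ℕ → Mean Str
word zero    = return []
word (suc n) = bind (word n) (λ w → push (_∷ w) coin)

product : ∀ {A d} → Vec (Mean A) d → Mean (Vec A d)
product []       = return []
product (m ∷ ms) = bind (product ms) (λ as → push (_∷ as) m)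

flips : ∀ d → Mean (Vec Bit d)
flips d = product (Vec.replicate d coin)

words : ∀ {d} → Vec ℕ d → Mean (Vec Str d)
words ns = product (Vec.map word ns)

𝔼-average : ∀ {A} (m : Mean A) f g → 𝔼 m (λ a → ½ * (f a + g a)) ≡ ½ * (𝔼 m f + 𝔼 m g)
𝔼-average m f g = trans (𝔼-* m ½ (λ a → f a + g a)) (cong (½ *_) (𝔼-+ m f g))

-- A coin is an average of two values, so linearity of `m` alone gives this exchange; no Fubini
-- theorem for arbitrary functionals is involved.
𝔼-coin-comm : ∀ {A} (m : Mean A) (f : A → Bit → ℚ) →
              𝔼 m (λ a → 𝔼 coin (f a)) ≡ 𝔼 coin (λ c → 𝔼 m (λ a → f a c))
𝔼-coin-comm m f = 𝔼-average m (λ a → f a 0b) (λ a → f a 1b)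

word-head : ∀ n f → 𝔼 (word (suc n)) f ≡ 𝔼 coin (λ c → 𝔼 (word n) (λ w → f (c ∷ w)))
word-head n f = 𝔼-coin-comm (word n) (λ w c → f (c ∷ w))

-- The first letters are independent of everything behind them. The majority can thus be taken over
-- plain coin flips before the tails are averaged.
words-heads : ∀ {d} (ns : Vec ℕ d) f →
              𝔼 (words (Vec.map suc ns)) f ≡ 𝔼 (flips d) (λ cs → 𝔼 (words ns) (λ t → f (Vec.zipWith _∷_ cs t)))
words-heads []       f = refl
words-heads {suc d} (n ∷ ns) f = begin
  𝔼 (words (Vec.map suc ns)) (λ t → 𝔼 (word (suc n)) (λ X → f (X ∷ t)))
    ≡⟨ words-heads ns (λ t → 𝔼 (word (suc n)) (λ X → f (X ∷ t))) ⟩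
  𝔼 (flips d) (λ cs → 𝔼 (words ns) (λ t → 𝔼 (word (suc n)) (λ X → f (X ∷ Vec.zipWith _∷_ cs t))))
    ≡⟨ 𝔼-cong (flips d) (λ cs → 𝔼-cong (words ns) (λ t → word-head n (λ X → f (X ∷ Vec.zipWith _∷_ cs t)))) ⟩
  𝔼 (flips d) (λ cs → 𝔼 (words ns) (λ t → 𝔼 coin (λ c → 𝔼 (word n) (λ w → f ((c ∷ w) ∷ Vec.zipWith _∷_ cs t)))))
    ≡⟨ 𝔼-cong (flips d) (λ cs → 𝔼-coin-comm (words ns) (λ t c → 𝔼 (word n) (λ w → f ((c ∷ w) ∷ Vec.zipWith _∷_ cs t)))) ⟩
  𝔼 (flips (suc d)) (λ cs → 𝔼 (words (n ∷ ns)) (λ t → f (Vec.zipWith _∷_ cs t)))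
    ∎
  where open ≡-Reasoning

-- The greedy procedure

-- after₁ b φ X is φ of what remains of X behind its first b, and 1 (failure) if X has no b;
-- after b H does this in all strings at once.
after₁ : Bit → (Str → ℚ) → Str → ℚ
after₁ b φ []      = 1ℚ
after₁ b φ (c ∷ X) = if does (c FinP.≟ b) then φ X else after₁ b φ X

after : ∀ {d} → Bit → (Vec Str d → ℚ) → Vec Str d → ℚ
after b H []       = H []
after b H (X ∷ Xs) = after b (λ t → after₁ b (λ Y → H (Y ∷ t)) X) Xs

after₁-cong : ∀ b {φ ψ} → (∀ Y → φ Y ≡ ψ Y) → ∀ X → after₁ b φ X ≡ after₁ b ψ X
after₁-cong b φ≗ψ []      = refl
after₁-cong b φ≗ψ (c ∷ X) with does (c FinP.≟ b)
... | true  = φ≗ψ X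
... | false = after₁-cong b φ≗ψ X

after-cong : ∀ {d} b {H G : Vec Str d → ℚ} → (∀ t → H t ≡ G t) → ∀ Xs → after b H Xs ≡ after b G Xs
after-cong b H≗G []       = H≗G []
after-cong b H≗G (X ∷ Xs) = after-cong b (λ t → after₁-cong b (λ Y → H≗G (Y ∷ t)) X) Xs

-- For a fixed string the value is either `φ` at one fixed suffix or the constant 1, so the
-- expectation passes inside; failure needs only that `m` has total mass 1.
𝔼-after₁ : ∀ {A} (m : Mean A) b (φ : A → Str → ℚ) X →
           𝔼 m (λ a → after₁ b (φ a) X) ≡ after₁ b (λ Y → 𝔼 m (λ a → φ a Y)) X
𝔼-after₁ m b φ []      = 𝔼-const m 1ℚ
𝔼-after₁ m b φ (c ∷ X) with does (c FinP.≟ b)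
... | true  = refl
... | false = 𝔼-after₁ m b φ X

𝔼-after : ∀ {A d} (m : Mean A) b (H : A → Vec Str d → ℚ) Xs →
          𝔼 m (λ a → after b (H a) Xs) ≡ after b (λ t → 𝔼 m (λ a → H a t)) Xs
𝔼-after m b H []       = refl
𝔼-after m b H (X ∷ Xs) = trans (𝔼-after m b (λ a t → after₁ b (λ Y → H a (Y ∷ t)) X) Xs)
                               (after-cong b (λ t → 𝔼-after₁ m b (λ a Y → H a (Y ∷ t)) X) Xs)

after₁-split : ∀ b φ X → after₁ b φ X ≡ 1ℚ ⊎
               ∃[ Y ] (after₁ b φ X ≡ φ Y × (∀ {w} → w ⊆ Y → b ∷ w ⊆ X))
after₁-split b φ []      = inj₁ refl
after₁-split b φ (c ∷ X) with c FinP.≟ b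
... | yes refl = inj₂ (X , refl , refl ∷_)
... | no _ with after₁-split b φ X
...   | inj₁ eq              = inj₁ eq
...   | inj₂ (Y , eq , lift) = inj₂ (Y , eq , λ w⊆Y → c ∷ʳ lift w⊆Y)

after-split : ∀ {d} b (H : Vec Str d → ℚ) Xs → after b H Xs ≡ 1ℚ ⊎
              ∃[ Ys ] (after b H Xs ≡ H Ys × (∀ {w} → VAll.All (w ⊆_) Ys → VAll.All ((b ∷ w) ⊆_) Xs))
after-split b H []       = inj₂ ([] , refl , λ _ → VAll.[])
after-split b H (X ∷ Xs) with after-split b (λ t → after₁ b (λ Y → H (Y ∷ t)) X) Xs
... | inj₁ eq = inj₁ eq
... | inj₂ (Ys , eq , lifts) with after₁-split b (λ Y → H (Y ∷ Ys)) X
...   | inj₁ eq₁              = inj₁ (trans eq eq₁)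
...   | inj₂ (Y , eq₁ , lift) = inj₂ ((Y ∷ Ys) , trans eq eq₁ , λ { (p VAll.∷ ps) → lift p VAll.∷ lifts ps })

-- Exponential potential of the letters that remain

Σᵥ : ∀ {d} → Vec ℚ d → ℚ
Σᵥ []       = 0ℚ
Σᵥ (w ∷ ws) = w + Σᵥ ws

charge : ∀ {d} → (Bit → ℚ) → Vec Bit d → Vec ℚ d → ℚ
charge ρ []       []       = 0ℚ
charge ρ (c ∷ cs) (w ∷ ws) = ρ c * w + charge ρ cs ws

-- r discounts one letter; κ bounds the discounted waiting time for the first b.
module Discount (r κ : ℚ) (0≤r : 0ℚ ≤ r) (1≤κ : 1ℚ ≤ κ) (wait : ½ * (1ℚ + κ) ≤ κ * r) where

  -- The factor on the potential of the letters behind a revealed first letter `c`: nothing more is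
  -- consumed on a hit, and a full waiting time for `b` follows on a miss.
  cost : Bit → Bit → ℚ
  cost b c = if does (c FinP.≟ b) then 1ℚ else κ

  potentials : ∀ {d} → Vec ℕ d → Vec ℚ d
  potentials = Vec.map (r ^_)

  0≤Σ : ∀ {d} (ns : Vec ℕ d) → 0ℚ ≤ Σᵥ (potentials ns)
  0≤Σ []       = ≤-refl
  0≤Σ (n ∷ ns) = 0≤+ (0≤^ n 0≤r) (0≤Σ ns)

  0≤κ : 0ℚ ≤ κ
  0≤κ = ≤-trans 0≤1 1≤κ

  module _ {A} (m : Mean A) (φ : A → Str → ℚ) (C K : ℚ) (1≤C : 1ℚ ≤ C) (0≤K : 0ℚ ≤ K)
           (bound : ∀ n → 𝔼 m (λ a → 𝔼 (word n) (φ a)) ≤ C * r ^ n + K) where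

    private
      0≤C : 0ℚ ≤ C
      0≤C = ≤-trans 0≤1 1≤C

      𝔼-cons : ∀ b n → 𝔼 m (λ a → 𝔼 (word (suc n)) (after₁ b (φ a))) ≡
               𝔼 coin (λ c → 𝔼 m (λ a → 𝔼 (word n) (λ w → after₁ b (φ a) (c ∷ w))))
      𝔼-cons b n = trans (𝔼-cong m (λ a → word-head n (after₁ b (φ a))))
                         (𝔼-coin-comm m (λ a c → 𝔼 (word n) (λ w → after₁ b (φ a) (c ∷ w))))

    -- First-step analysis: a hit leaves the assumed bound, a miss the same waiting problem on one
    -- letter less, and `wait` closes the recursion. At the end of the string the failure value 1
    -- equals r^0, which `1≤C` and `1≤κ` absorb. `m` averages over the other strings, and `K` holds
    -- their share.
    𝔼-wait : ∀ b n → 𝔼 m (λ a → 𝔼 (word n) (after₁ b (φ a))) ≤ C * (κ * r ^ n) + K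
    𝔼-wait b zero = begin
      𝔼 m (λ a → 1ℚ)         ≡⟨ 𝔼-const m 1ℚ ⟩
      1ℚ * (1ℚ * 1ℚ) + 0ℚ    ≤⟨ +-mono-≤ (*-mono 0≤1 (0≤* 0≤κ 0≤1) 1≤C (*-monoʳ 1ℚ 0≤1 1≤κ)) 0≤K ⟩
      C * (κ * 1ℚ) + K       ∎
      where open ≤-Reasoning
    𝔼-wait b (suc n) = begin
      𝔼 m (λ a → 𝔼 (word (suc n)) (after₁ b (φ a)))        ≡⟨ 𝔼-cons b n ⟩
      𝔼 coin (λ c → 𝔼 m (λ a → 𝔼 (word n) (λ w → after₁ b (φ a) (c ∷ w))))
                                                            ≤⟨ hit-or-miss b ⟩
      ½ * (C * r ^ n + K + (C * (κ * r ^ n) + K))           ≡⟨ identity C K κ (r ^ n) ⟩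
      C * (½ * (1ℚ + κ) * r ^ n) + K                        ≤⟨ +-monoˡ-≤ K (*-monoˡ C 0≤C (*-monoʳ (r ^ n) (0≤^ n 0≤r) wait)) ⟩
      C * (κ * r * r ^ n) + K                               ≡⟨ cong (λ z → C * z + K) (*-assoc κ r (r ^ n)) ⟩
      C * (κ * r ^ suc n) + K                               ∎
      where
      open ≤-Reasoning
      hit-or-miss : ∀ b → 𝔼 coin (λ c → 𝔼 m (λ a → 𝔼 (word n) (λ w → after₁ b (φ a) (c ∷ w))))
                          ≤ ½ * (C * r ^ n + K + (C * (κ * r ^ n) + K))
      hit-or-miss 0b = average (bound n) (𝔼-wait 0b n)
      hit-or-miss 1b = subst (_ ≤_) (cong (½ *_) (+-comm (C * (κ * r ^ n) + K) (C * r ^ n + K)))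
                             (average (𝔼-wait 1b n) (bound n))
      identity : ∀ C K κ p → ½ * (C * p + K + (C * (κ * p) + K)) ≡ C * (½ * (1ℚ + κ) * p) + K
      identity = solve-∀ ℚ-ring

    𝔼-after₁-cons : ∀ b c n → 𝔼 m (λ a → 𝔼 (word n) (λ w → after₁ b (φ a) (c ∷ w))) ≤ C * (cost b c * r ^ n) + K
    𝔼-after₁-cons b c n with does (c FinP.≟ b)
    ... | true  = subst (λ z → _ ≤ C * z + K) (sym (*-identityˡ (r ^ n))) (bound n)
    ... | false = 𝔼-wait b n

  -- The strings are resolved one at a time. Once the head string is averaged out, its share is a
  -- constant that joins `K`; this is why the hypothesis on `H` is affine in the potential and
  -- quantifies over all lengths.
  𝔼-after-zip : ∀ {d} b (H : Vec Str d → ℚ) C K → 1ℚ ≤ C → 0ℚ ≤ K →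
                (∀ ns → 𝔼 (words ns) H ≤ C * Σᵥ (potentials ns) + K) →
                ∀ cs ns → 𝔼 (words ns) (λ t → after b H (Vec.zipWith _∷_ cs t))
                          ≤ C * charge (cost b) cs (potentials ns) + K
  𝔼-after-zip b H C K 1≤C 0≤K bound []       []       = bound []
  𝔼-after-zip b H C K 1≤C 0≤K bound (c ∷ cs) (n ∷ ns) = begin
    𝔼 (words ns) (λ t → 𝔼 (word n) (λ w → after b (λ t′ → after₁ b (λ Y → H (Y ∷ t′)) (c ∷ w)) (Vec.zipWith _∷_ cs t)))
      ≡⟨ 𝔼-cong (words ns) (λ t → 𝔼-after (word n) b (λ w t′ → after₁ b (λ Y → H (Y ∷ t′)) (c ∷ w)) (Vec.zipWith _∷_ cs t)) ⟩
    𝔼 (words ns) (λ t → after b H′ (Vec.zipWith _∷_ cs t))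
      ≤⟨ 𝔼-after-zip b H′ C K′ 1≤C (0≤+ (0≤* 0≤C (0≤* (0≤cost c) (0≤^ n 0≤r))) 0≤K) bound′ cs ns ⟩
    C * charge (cost b) cs (potentials ns) + K′
      ≡⟨ identity C _ (cost b c * r ^ n) K ⟩
    C * charge (cost b) (c ∷ cs) (potentials (n ∷ ns)) + K
      ∎
    where
    open ≤-Reasoning
    0≤C = ≤-trans 0≤1 1≤C
    0≤cost : ∀ c → 0ℚ ≤ cost b c
    0≤cost c with does (c FinP.≟ b)
    ... | true  = 0≤1
    ... | false = 0≤κ
    H′ = λ t′ → 𝔼 (word n) (λ w → after₁ b (λ Y → H (Y ∷ t′)) (c ∷ w))
    K′ = C * (cost b c * r ^ n) + K
    identity : ∀ C x y K → C * x + (C * y + K) ≡ C * (y + x) + K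
    identity = solve-∀ ℚ-ring
    identity′ : ∀ C x y K → C * (y + x) + K ≡ C * y + (C * x + K)
    identity′ = solve-∀ ℚ-ring
    identity″ : ∀ C x y K → C * y + (C * x + K) ≡ C * x + (C * y + K)
    identity″ = solve-∀ ℚ-ring
    bound′ : ∀ ns′ → 𝔼 (words ns′) H′ ≤ C * Σᵥ (potentials ns′) + K′
    bound′ ns′ = subst (_ ≤_) (identity″ C (Σᵥ (potentials ns′)) (cost b c * r ^ n) K)
      (𝔼-after₁-cons (words ns′) (λ t′ Y → H (Y ∷ t′)) C (C * Σᵥ (potentials ns′) + K) 1≤C
        (0≤+ (0≤* 0≤C (0≤Σ ns′)) 0≤K)
        (λ n′ → subst (_ ≤_) (identity′ C (Σᵥ (potentials ns′)) (r ^ n′) K) (bound (n′ ∷ ns′)))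
        b c n)

-- Exchangeability of the first letters and the cost of one round

count : ∀ {d} → Vec Bit d → ℕ
count []       = 0
count (c ∷ cs) = Fin.toℕ c ℕ.+ count cs

-- The count is symmetric in the coordinates, so every coordinate has the same expected factor and
-- it comes out of the weighted sum. `Φ` is arbitrary so that the induction can absorb the shift of
-- the count by the coin already revealed.
𝔼-charge : ∀ d (Φ : Bit → ℕ → ℚ) (ws : Vec ℚ (suc d)) →
           𝔼 (flips (suc d)) (λ cs → charge (λ c → Φ c (count cs)) cs ws)
           ≡ 𝔼 coin (λ c → 𝔼 (flips d) (λ cs → Φ c (Fin.toℕ c ℕ.+ count cs))) * Σᵥ ws
𝔼-charge zero    Φ (w ∷ []) = identity (Φ 0b 0) (Φ 1b 1) w
  where
  identity : ∀ a b w → ½ * (a * w + 0ℚ + (b * w + 0ℚ)) ≡ ½ * (a + b) * (w + 0ℚ)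
  identity = solve-∀ ℚ-ring
𝔼-charge (suc d) Φ (w ∷ ws) = begin
  𝔼 m (λ cs → 𝔼 coin (λ c → Φ c (Fin.toℕ c ℕ.+ count cs) * w + charge (λ c′ → Φ c′ (Fin.toℕ c ℕ.+ count cs)) cs ws))
    ≡⟨ 𝔼-coin-comm m (λ cs c → Φ c (Fin.toℕ c ℕ.+ count cs) * w + charge (λ c′ → Φ c′ (Fin.toℕ c ℕ.+ count cs)) cs ws) ⟩
  𝔼 coin (λ c → 𝔼 m (λ cs → Φ c (Fin.toℕ c ℕ.+ count cs) * w + charge (λ c′ → Φ c′ (Fin.toℕ c ℕ.+ count cs)) cs ws))
    ≡⟨ 𝔼-cong coin split ⟩
  𝔼 coin (λ c → q c * w + 𝔼 coin (λ c′ → q′ c′ c) * Σᵥ ws)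
    ≡⟨ 𝔼-+ coin (λ c → q c * w) (λ c → 𝔼 coin (λ c′ → q′ c′ c) * Σᵥ ws) ⟩
  𝔼 coin (λ c → q c * w) + 𝔼 coin (λ c → 𝔼 coin (λ c′ → q′ c′ c) * Σᵥ ws)
    ≡⟨ cong₂ _+_ (𝔼-*ʳ coin q w) (𝔼-*ʳ coin (λ c → 𝔼 coin (λ c′ → q′ c′ c)) (Σᵥ ws)) ⟩
  𝔼 coin q * w + 𝔼 coin (λ c → 𝔼 coin (λ c′ → q′ c′ c)) * Σᵥ ws
    ≡⟨ cong (λ z → 𝔼 coin q * w + z * Σᵥ ws) (sym (trans (𝔼-cong coin swap) (𝔼-coin-comm coin q′))) ⟩
  𝔼 coin q * w + 𝔼 coin q * Σᵥ ws
    ≡⟨ *-distribˡ-+ (𝔼 coin q) w (Σᵥ ws) ⟨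
  𝔼 coin q * (w + Σᵥ ws)
    ∎
  where
  open ≡-Reasoning
  m = flips (suc d)
  q : Bit → ℚ
  q c = 𝔼 m (λ cs → Φ c (Fin.toℕ c ℕ.+ count cs))
  q′ : Bit → Bit → ℚ
  q′ c′ c = 𝔼 (flips d) (λ cs → Φ c′ (Fin.toℕ c ℕ.+ (Fin.toℕ c′ ℕ.+ count cs)))
  split : ∀ c → 𝔼 m (λ cs → Φ c (Fin.toℕ c ℕ.+ count cs) * w + charge (λ c′ → Φ c′ (Fin.toℕ c ℕ.+ count cs)) cs ws)
                ≡ q c * w + 𝔼 coin (λ c′ → q′ c′ c) * Σᵥ ws
  split c = trans (𝔼-+ m (λ cs → Φ c (Fin.toℕ c ℕ.+ count cs) * w) (λ cs → charge (λ c′ → Φ c′ (Fin.toℕ c ℕ.+ count cs)) cs ws))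
                  (cong₂ _+_ (𝔼-*ʳ m (λ cs → Φ c (Fin.toℕ c ℕ.+ count cs)) w)
                             (𝔼-charge d (λ c′ s → Φ c′ (Fin.toℕ c ℕ.+ s)) ws))
  x+[y+z] : ∀ x y z → x ℕ.+ (y ℕ.+ z) ≡ y ℕ.+ (x ℕ.+ z)
  x+[y+z] = ℕSolver.solve-∀
  swap : ∀ c′ → q c′ ≡ 𝔼 coin (q′ c′)
  swap c′ = trans (𝔼-coin-comm (flips d) (λ cs c → Φ c′ (Fin.toℕ c′ ℕ.+ (Fin.toℕ c ℕ.+ count cs))))
                  (𝔼-cong coin (λ c → 𝔼-cong (flips d) (λ cs → cong (Φ c′) (x+[y+z] (Fin.toℕ c′) (Fin.toℕ c) (count cs)))))

-- Every threshold k is allowed, not only half the number of strings.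
majority : ℕ → ℕ → Bit
majority k s = if k ℕ.<ᵇ s then 1b else 0b

𝟙 : Bool → ℚ
𝟙 b = if b then 1ℚ else 0ℚ

ℙ[count≡_] : ℕ → ℕ → ℚ
ℙ[count≡ k ] d = 𝔼 (flips d) (λ cs → 𝟙 (count cs ℕ.≡ᵇ k))

-- The default letter has no effect on `bad`: as soon as one string is empty, `after` returns the
-- failure value 1 for either letter.
first : Str → Bit
first []      = 0b
first (c ∷ _) = c

firsts-zip : ∀ {d} (cs : Vec Bit d) (t : Vec Str d) → Vec.map first (Vec.zipWith _∷_ cs t) ≡ cs
firsts-zip []       []      = refl
firsts-zip (c ∷ cs) (X ∷ t) = cong (c ∷_) (firsts-zip cs t)

-- bad k m Xs is 1 if m rounds of the greedy procedure do not fit into Xs, and 0 otherwise.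
bad : ∀ {d} → ℕ → ℕ → Vec Str d → ℚ
bad k zero    Xs = 0ℚ
bad k (suc m) Xs = after (majority k (count (Vec.map first Xs))) (bad k m) Xs

bad-split : ∀ {d} k m (Xs : Vec Str d) → bad k m Xs ≡ 1ℚ ⊎
            (bad k m Xs ≡ 0ℚ × ∃[ w ] (length w ≡ m × VAll.All (w ⊆_) Xs))
bad-split k zero    Xs = inj₂ (refl , [] , refl , VAll.universal minimum Xs)
bad-split k (suc m) Xs with after-split (majority k (count (Vec.map first Xs))) (bad k m) Xs
... | inj₁ eq = inj₁ eq
... | inj₂ (Ys , eq , lift) with bad-split k m Ys
...   | inj₁ eq′                 = inj₁ (trans eq eq′)
...   | inj₂ (eq′ , w , ∣w∣ , ps) = inj₂ (trans eq eq′ , _ ∷ w , cong suc ∣w∣ , lift ps)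

bad≤1 : ∀ {d} k m (Xs : Vec Str d) → bad k m Xs ≤ 1ℚ
bad≤1 k m Xs with bad-split k m Xs
... | inj₁ eq       = ≤-reflexive eq
... | inj₂ (eq , _) = ≤-trans (≤-reflexive eq) 0≤1

module Greedy (r κ : ℚ) (0≤r : 0ℚ ≤ r) (1≤κ : 1ℚ ≤ κ) (wait : ½ * (1ℚ + κ) ≤ κ * r) where

  open Discount r κ 0≤r 1≤κ wait

  -- A fixed string agrees with the majority with probability ½, except that it always agrees if the
  -- d other letters tie.
  round-cost : ∀ d k → 𝔼 coin (λ c → 𝔼 (flips d) (λ cs → cost (majority k (Fin.toℕ c ℕ.+ count cs)) c))
                       ≡ ½ * (1ℚ + κ) + (- (½ * (κ - 1ℚ))) * ℙ[count≡ k ] d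
  round-cost d k = begin
    𝔼 coin (λ c → 𝔼 m (λ cs → cost (majority k (Fin.toℕ c ℕ.+ count cs)) c))
      ≡⟨ 𝔼-coin-comm m (λ cs c → cost (majority k (Fin.toℕ c ℕ.+ count cs)) c) ⟨
    𝔼 m (λ cs → 𝔼 coin (λ c → cost (majority k (Fin.toℕ c ℕ.+ count cs)) c))
      ≡⟨ 𝔼-cong m (λ cs → at k (count cs)) ⟩
    𝔼 m (λ cs → ½ * (1ℚ + κ) + (- (½ * (κ - 1ℚ))) * 𝟙 (count cs ℕ.≡ᵇ k))
      ≡⟨ 𝔼-+ m (λ _ → ½ * (1ℚ + κ)) (λ cs → (- (½ * (κ - 1ℚ))) * 𝟙 (count cs ℕ.≡ᵇ k)) ⟩
    𝔼 m (λ _ → ½ * (1ℚ + κ)) + 𝔼 m (λ cs → (- (½ * (κ - 1ℚ))) * 𝟙 (count cs ℕ.≡ᵇ k))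
      ≡⟨ cong₂ _+_ (𝔼-const m (½ * (1ℚ + κ))) (𝔼-* m (- (½ * (κ - 1ℚ))) (λ cs → 𝟙 (count cs ℕ.≡ᵇ k))) ⟩
    ½ * (1ℚ + κ) + (- (½ * (κ - 1ℚ))) * ℙ[count≡ k ] d
      ∎
    where
    open ≡-Reasoning
    m = flips d
    tie : ∀ κ → ½ * (1ℚ + 1ℚ) ≡ ½ * (1ℚ + κ) + (- (½ * (κ - 1ℚ))) * 1ℚ
    tie = solve-∀ ℚ-ring
    below : ∀ κ → ½ * (1ℚ + κ) ≡ ½ * (1ℚ + κ) + (- (½ * (κ - 1ℚ))) * 0ℚ
    below = solve-∀ ℚ-ring
    above : ∀ κ → ½ * (κ + 1ℚ) ≡ ½ * (1ℚ + κ) + (- (½ * (κ - 1ℚ))) * 0ℚ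
    above = solve-∀ ℚ-ring
    at : ∀ k s → 𝔼 coin (λ c → cost (majority k (Fin.toℕ c ℕ.+ s)) c)
                 ≡ ½ * (1ℚ + κ) + (- (½ * (κ - 1ℚ))) * 𝟙 (s ℕ.≡ᵇ k)
    at zero    zero    = tie κ
    at zero    (suc s) = above κ
    at (suc k) zero    = below κ
    at (suc k) (suc s) = at k s

  -- An exhausted string has potential r^0 = 1. The total then already exceeds any probability, so a
  -- round is analysed only when every string has a first letter.
  split-positive : ∀ {d} (ns : Vec ℕ d) → (∃[ ns′ ] ns ≡ Vec.map suc ns′) ⊎ 1ℚ ≤ Σᵥ (potentials ns)
  split-positive []           = inj₁ ([] , refl)
  split-positive (zero ∷ ns)  = inj₂ (≤-by (Σᵥ (potentials ns)) (0≤Σ ns) refl)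
  split-positive (suc n ∷ ns) with split-positive ns
  ... | inj₁ (ns′ , refl) = inj₁ (n ∷ ns′ , refl)
  ... | inj₂ 1≤Σ          = inj₂ (≤-trans 1≤Σ (≤-by (r ^ suc n) (0≤^ (suc n) 0≤r) (+-comm (Σᵥ (potentials ns)) (r ^ suc n))))

  Σ-suc : ∀ {d} (ns : Vec ℕ d) → Σᵥ (potentials (Vec.map suc ns)) ≡ r * Σᵥ (potentials ns)
  Σ-suc []       = sym (*-zeroʳ r)
  Σ-suc (n ∷ ns) = trans (cong (_+_ (r ^ suc n)) (Σ-suc ns)) (sym (*-distribˡ-+ r (r ^ n) (Σᵥ (potentials ns))))

  module _ {d} (k : ℕ) (M : ℚ) (1≤M : 1ℚ ≤ M)
           (round : ½ * (1ℚ + κ) + (- (½ * (κ - 1ℚ))) * ℙ[count≡ k ] d ≤ M * r) where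

    -- A supermartingale bound: one round multiplies the expected potential by at most `M`. The
    -- factor `r` in `round` accounts for the first letters, which every string gives up (`Σ-suc`).
    𝔼-bad : ∀ m (ns : Vec ℕ (suc d)) → 𝔼 (words ns) (bad k m) ≤ M ^ m * Σᵥ (potentials ns)
    𝔼-bad zero ns = begin
      𝔼 (words ns) (λ _ → 0ℚ)        ≡⟨ 𝔼-const (words ns) 0ℚ ⟩
      0ℚ                              ≤⟨ 0≤* 0≤1 (0≤Σ ns) ⟩
      1ℚ * Σᵥ (potentials ns)         ∎
      where open ≤-Reasoning
    𝔼-bad (suc m) ns with split-positive ns
    ... | inj₂ 1≤Σ = begin
      𝔼 (words ns) (bad k (suc m))    ≤⟨ 𝔼-mono (words ns) (bad≤1 k (suc m)) ⟩
      𝔼 (words ns) (λ _ → 1ℚ)         ≡⟨ 𝔼-const (words ns) 1ℚ ⟩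
      1ℚ * 1ℚ                         ≤⟨ *-mono 0≤1 (0≤Σ ns) (1≤^ (suc m) 1≤M) 1≤Σ ⟩
      M ^ suc m * Σᵥ (potentials ns)  ∎
      where open ≤-Reasoning
    ... | inj₁ (ns′ , refl) = begin
      𝔼 (words (Vec.map suc ns′)) (bad k (suc m))
        ≡⟨ words-heads ns′ (bad k (suc m)) ⟩
      𝔼 (flips (suc d)) (λ cs → 𝔼 (words ns′) (λ t → bad k (suc m) (Vec.zipWith _∷_ cs t)))
        ≡⟨ 𝔼-cong (flips (suc d)) (λ cs → 𝔼-cong (words ns′) (λ t →
             cong (λ z → after (majority k (count z)) (bad k m) (Vec.zipWith _∷_ cs t)) (firsts-zip cs t))) ⟩
      𝔼 (flips (suc d)) (λ cs → 𝔼 (words ns′) (λ t → after (majority k (count cs)) (bad k m) (Vec.zipWith _∷_ cs t)))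
        ≤⟨ 𝔼-mono (flips (suc d)) one-round ⟩
      𝔼 (flips (suc d)) (λ cs → M ^ m * charge (cost (majority k (count cs))) cs (potentials ns′))
        ≡⟨ 𝔼-* (flips (suc d)) (M ^ m) (λ cs → charge (cost (majority k (count cs))) cs (potentials ns′)) ⟩
      M ^ m * 𝔼 (flips (suc d)) (λ cs → charge (cost (majority k (count cs))) cs (potentials ns′))
        ≡⟨ cong (M ^ m *_) (trans (𝔼-charge d (λ c s → cost (majority k s) c) (potentials ns′))
                                  (cong (_* Σᵥ (potentials ns′)) (round-cost d k))) ⟩
      M ^ m * ((½ * (1ℚ + κ) + (- (½ * (κ - 1ℚ))) * ℙ[count≡ k ] d) * Σᵥ (potentials ns′))
        ≤⟨ *-monoˡ (M ^ m) (0≤^ m (≤-trans 0≤1 1≤M)) (*-monoʳ (Σᵥ (potentials ns′)) (0≤Σ ns′) round) ⟩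
      M ^ m * (M * r * Σᵥ (potentials ns′))
        ≡⟨ identity (M ^ m) M r (Σᵥ (potentials ns′)) ⟩
      M * M ^ m * (r * Σᵥ (potentials ns′))
        ≡⟨ cong (M ^ suc m *_) (Σ-suc ns′) ⟨
      M ^ suc m * Σᵥ (potentials (Vec.map suc ns′))
        ∎
      where
      open ≤-Reasoning
      identity : ∀ p M r s → p * (M * r * s) ≡ M * p * (r * s)
      identity = solve-∀ ℚ-ring
      one-round : ∀ cs → 𝔼 (words ns′) (λ t → after (majority k (count cs)) (bad k m) (Vec.zipWith _∷_ cs t))
                         ≤ M ^ m * charge (cost (majority k (count cs))) cs (potentials ns′)
      one-round cs = subst (_ ≤_) (+-identityʳ _)
        (𝔼-after-zip (majority k (count cs)) (bad k m) (M ^ m) 0ℚ (1≤^ m 1≤M) ≤-refl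
          (λ ns → ≤-trans (𝔼-bad m ns) (≤-reflexive (sym (+-identityʳ _)))) cs ns′)

-- Central binomial coefficients

nC0≡1 : ∀ n → binomial n 0 ≡ 1
nC0≡1 n = trans (nCk≡nC[n∸k] {0} {n} z≤n) (nCn≡1 n)

-- This is (k+1) C(n,k+1) = (n-k) C(n,k) with the subtraction moved across, so that it also holds
-- for k > n.
[k+1]nC[k+1]+k*nCk≡n*nCk : ∀ n k → suc k ℕ.* binomial n (suc k) ℕ.+ k ℕ.* binomial n k ≡ n ℕ.* binomial n k
[k+1]nC[k+1]+k*nCk≡n*nCk zero    k       = cong₂ ℕ._+_ (ℕP.*-zeroʳ (suc k)) (k*0Ck≡0 k)
  where
  k*0Ck≡0 : ∀ k → k ℕ.* binomial 0 k ≡ 0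
  k*0Ck≡0 zero    = refl
  k*0Ck≡0 (suc k) = ℕP.*-zeroʳ (suc k)
[k+1]nC[k+1]+k*nCk≡n*nCk (suc n) zero    = begin
  1 ℕ.* binomial (suc n) 1 ℕ.+ 0        ≡⟨ cong (λ z → 1 ℕ.* z ℕ.+ 0) (nC1≡n (suc n)) ⟩
  1 ℕ.* suc n ℕ.+ 0                     ≡⟨ identity (suc n) ⟩
  suc n ℕ.* 1                           ≡⟨ cong (suc n ℕ.*_) (nC0≡1 (suc n)) ⟨
  suc n ℕ.* binomial (suc n) 0          ∎
  where
  open ≡-Reasoning
  identity : ∀ m → 1 ℕ.* m ℕ.+ 0 ≡ m ℕ.* 1
  identity = ℕSolver.solve-∀
[k+1]nC[k+1]+k*nCk≡n*nCk (suc n) (suc j) = begin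
  suc (suc j) ℕ.* binomial (suc n) (suc (suc j)) ℕ.+ suc j ℕ.* binomial (suc n) (suc j)
    ≡⟨ cong₂ (λ x y → suc (suc j) ℕ.* x ℕ.+ suc j ℕ.* y) (nCk+nC[k+1]≡[n+1]C[k+1] n (suc j)) (nCk+nC[k+1]≡[n+1]C[k+1] n j) ⟨
  suc (suc j) ℕ.* (b ℕ.+ c) ℕ.+ suc j ℕ.* (a ℕ.+ b)
    ≡⟨ regroup j a b c ⟩
  (suc (suc j) ℕ.* c ℕ.+ suc j ℕ.* b) ℕ.+ (suc j ℕ.* b ℕ.+ j ℕ.* a) ℕ.+ (a ℕ.+ b)
    ≡⟨ cong₂ (λ x y → x ℕ.+ y ℕ.+ (a ℕ.+ b)) ([k+1]nC[k+1]+k*nCk≡n*nCk n (suc j)) ([k+1]nC[k+1]+k*nCk≡n*nCk n j) ⟩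
  n ℕ.* b ℕ.+ n ℕ.* a ℕ.+ (a ℕ.+ b)
    ≡⟨ collect n a b ⟩
  suc n ℕ.* (a ℕ.+ b)
    ≡⟨ cong (suc n ℕ.*_) (nCk+nC[k+1]≡[n+1]C[k+1] n j) ⟩
  suc n ℕ.* binomial (suc n) (suc j)
    ∎
  where
  open ≡-Reasoning
  a = binomial n j
  b = binomial n (suc j)
  c = binomial n (suc (suc j))
  regroup : ∀ j a b c → (2 ℕ.+ j) ℕ.* (b ℕ.+ c) ℕ.+ (1 ℕ.+ j) ℕ.* (a ℕ.+ b)
            ≡ ((2 ℕ.+ j) ℕ.* c ℕ.+ (1 ℕ.+ j) ℕ.* b) ℕ.+ ((1 ℕ.+ j) ℕ.* b ℕ.+ j ℕ.* a) ℕ.+ (a ℕ.+ b)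
  regroup = ℕSolver.solve-∀
  collect : ∀ n a b → n ℕ.* b ℕ.+ n ℕ.* a ℕ.+ (a ℕ.+ b) ≡ (1 ℕ.+ n) ℕ.* (a ℕ.+ b)
  collect = ℕSolver.solve-∀

central : ℕ → ℕ
central k = binomial (2 ℕ.* k) k

-- The two middle entries of row 2k+1 agree (`A≡B`), so the new central entry is twice one of them;
-- the preceding identity in row 2k evaluates that one.
central-step : ∀ k → suc k ℕ.* central (suc k) ≡ 2 ℕ.* (1 ℕ.+ 2 ℕ.* k) ℕ.* central k
central-step k = begin
  suc k ℕ.* binomial (2 ℕ.* suc k) (suc k)   ≡⟨ cong (λ n → suc k ℕ.* binomial n (suc k)) (ℕP.*-suc 2 k) ⟩
  suc k ℕ.* binomial (2 ℕ.+ n) (suc k)       ≡⟨ cong (suc k ℕ.*_) (nCk+nC[k+1]≡[n+1]C[k+1] (suc n) k) ⟨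
  suc k ℕ.* (B ℕ.+ A)                        ≡⟨ cong (λ z → suc k ℕ.* (z ℕ.+ A)) A≡B ⟨
  suc k ℕ.* (A ℕ.+ A)                        ≡⟨ double k A ⟩
  2 ℕ.* (suc k ℕ.* A)                        ≡⟨ cong (λ z → 2 ℕ.* (suc k ℕ.* z)) (nCk+nC[k+1]≡[n+1]C[k+1] n k) ⟨
  2 ℕ.* (suc k ℕ.* (c ℕ.+ c′))               ≡⟨ cong (2 ℕ.*_) (ℕP.+-cancelʳ-≡ (k ℕ.* c) _ _ expand) ⟩
  2 ℕ.* ((1 ℕ.+ 2 ℕ.* k) ℕ.* c)              ≡⟨ ℕP.*-assoc 2 (1 ℕ.+ 2 ℕ.* k) c ⟨
  2 ℕ.* (1 ℕ.+ 2 ℕ.* k) ℕ.* c                ∎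
  where
  open ≡-Reasoning
  n  = 2 ℕ.* k
  c  = binomial n k
  c′ = binomial n (suc k)
  A  = binomial (suc n) (suc k)
  B  = binomial (suc n) k
  double : ∀ k A → (1 ℕ.+ k) ℕ.* (A ℕ.+ A) ≡ 2 ℕ.* ((1 ℕ.+ k) ℕ.* A)
  double = ℕSolver.solve-∀
  shift : ∀ k B → (1 ℕ.+ 2 ℕ.* k) ℕ.* B ≡ (1 ℕ.+ k) ℕ.* B ℕ.+ k ℕ.* B
  shift = ℕSolver.solve-∀
  A≡B : A ≡ B
  A≡B = ℕP.*-cancelˡ-≡ A B (suc k)
          (ℕP.+-cancelʳ-≡ (k ℕ.* B) _ _ (trans ([k+1]nC[k+1]+k*nCk≡n*nCk (suc n) k) (shift k B)))
  factor : ∀ k c c′ → (1 ℕ.+ k) ℕ.* (c ℕ.+ c′) ℕ.+ k ℕ.* c ≡ (1 ℕ.+ k) ℕ.* c ℕ.+ ((1 ℕ.+ k) ℕ.* c′ ℕ.+ k ℕ.* c)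
  factor = ℕSolver.solve-∀
  factor′ : ∀ k c → (1 ℕ.+ k) ℕ.* c ℕ.+ 2 ℕ.* k ℕ.* c ≡ (1 ℕ.+ 2 ℕ.* k) ℕ.* c ℕ.+ k ℕ.* c
  factor′ = ℕSolver.solve-∀
  expand : suc k ℕ.* (c ℕ.+ c′) ℕ.+ k ℕ.* c ≡ (1 ℕ.+ 2 ℕ.* k) ℕ.* c ℕ.+ k ℕ.* c
  expand = trans (factor k c c′) (trans (cong (suc k ℕ.* c ℕ.+_) ([k+1]nC[k+1]+k*nCk≡n*nCk n k)) (factor′ k c))

-- The square of C(2k,k) ≥ 4^k/(2√k). There is equality at k = 1, and the ratio of the two sides
-- improves with k because (2k+1)² exceeds 4k(k+1).
wallis : ∀ k → 16 ℕ.^ suc k ℕ.≤ 4 ℕ.* suc k ℕ.* (central (suc k) ℕ.* central (suc k))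
wallis zero    = ℕP.≤-refl
wallis (suc k) = ℕP.*-cancelˡ-≤ (suc K) (begin
  suc K ℕ.* (16 ℕ.* 16 ℕ.^ K)                              ≤⟨ ℕP.*-monoʳ-≤ (suc K) (ℕP.*-monoʳ-≤ 16 (wallis k)) ⟩
  suc K ℕ.* (16 ℕ.* (4 ℕ.* K ℕ.* (c ℕ.* c)))               ≤⟨ ℕP.m≤m+n _ (16 ℕ.* (c ℕ.* c)) ⟩
  suc K ℕ.* (16 ℕ.* (4 ℕ.* K ℕ.* (c ℕ.* c))) ℕ.+ 16 ℕ.* (c ℕ.* c)
                                                           ≡⟨ complete-square K c ⟩
  4 ℕ.* (2 ℕ.* (1 ℕ.+ 2 ℕ.* K) ℕ.* c ℕ.* (2 ℕ.* (1 ℕ.+ 2 ℕ.* K) ℕ.* c))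
                                                           ≡⟨ cong (λ z → 4 ℕ.* (z ℕ.* z)) (central-step K) ⟨
  4 ℕ.* (suc K ℕ.* c′ ℕ.* (suc K ℕ.* c′))                  ≡⟨ rearrange K c′ ⟩
  suc K ℕ.* (4 ℕ.* suc K ℕ.* (c′ ℕ.* c′))                  ∎)
  where
  open ℕP.≤-Reasoning
  K  = suc k
  c  = central K
  c′ = central (suc K)
  complete-square : ∀ K c → (1 ℕ.+ K) ℕ.* (16 ℕ.* (4 ℕ.* K ℕ.* (c ℕ.* c))) ℕ.+ 16 ℕ.* (c ℕ.* c)
                    ≡ 4 ℕ.* (2 ℕ.* (1 ℕ.+ 2 ℕ.* K) ℕ.* c ℕ.* (2 ℕ.* (1 ℕ.+ 2 ℕ.* K) ℕ.* c))
  complete-square = ℕSolver.solve-∀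
  rearrange : ∀ K c → 4 ℕ.* ((1 ℕ.+ K) ℕ.* c ℕ.* ((1 ℕ.+ K) ℕ.* c)) ≡ (1 ℕ.+ K) ℕ.* (4 ℕ.* (1 ℕ.+ K) ℕ.* (c ℕ.* c))
  rearrange = ℕSolver.solve-∀

-- In the rows 2h² the square root in the Wallis bound is the integer `h`.
central-square : ∀ h .{{_ : ℕ.NonZero h}} → 2 ℕ.^ (2 ℕ.* (h ℕ.* h)) ℕ.≤ 2 ℕ.* h ℕ.* central (h ℕ.* h)
central-square h@(suc n) = ℕP.≮⇒≥ λ lt → ℕP.<-irrefl refl (begin-strict
  x ℕ.* x                                <⟨ ℕP.*-mono-< lt lt ⟩
  y ℕ.* y                                ≡⟨ cong (λ z → z ℕ.* z) (ℕP.^-*-assoc 2 2 (h ℕ.* h)) ⟨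
  4 ℕ.^ (h ℕ.* h) ℕ.* 4 ℕ.^ (h ℕ.* h)     ≡⟨ ^-distribʳ-* (h ℕ.* h) 4 4 ⟨
  16 ℕ.^ (h ℕ.* h)                       ≤⟨ wallis (n ℕ.+ n ℕ.* suc n) ⟩
  4 ℕ.* (h ℕ.* h) ℕ.* (c ℕ.* c)          ≡⟨ rearrange h c ⟩
  x ℕ.* x                                ∎)
  where
  open ℕP.≤-Reasoning
  c = central (h ℕ.* h)
  x = 2 ℕ.* h ℕ.* c
  y = 2 ℕ.^ (2 ℕ.* (h ℕ.* h))
  rearrange : ∀ h c → 4 ℕ.* (h ℕ.* h) ℕ.* (c ℕ.* c) ≡ 2 ℕ.* h ℕ.* c ℕ.* (2 ℕ.* h ℕ.* c)
  rearrange = ℕSolver.solve-∀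
  ^-distribʳ-* : ∀ n a b → (a ℕ.* b) ℕ.^ n ≡ a ℕ.^ n ℕ.* b ℕ.^ n
  ^-distribʳ-* zero    a b = refl
  ^-distribʳ-* (suc n) a b = trans (cong (a ℕ.* b ℕ.*_) (^-distribʳ-* n a b)) (interchange a b (a ℕ.^ n) (b ℕ.^ n))
    where
    interchange : ∀ a b x y → a ℕ.* b ℕ.* (x ℕ.* y) ≡ a ℕ.* x ℕ.* (b ℕ.* y)
    interchange = ℕSolver.solve-∀

-- By Pascal's rule the largest of the probabilities C(n,k)/2ⁿ does not increase with n.
binomial-descend : ∀ v n j → (∃[ k ] 2 ℕ.^ (j ℕ.+ n) ℕ.≤ v ℕ.* binomial (j ℕ.+ n) k) →
                   ∃[ k ] 2 ℕ.^ n ℕ.≤ v ℕ.* binomial n k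
binomial-descend v n zero    hyp = hyp
binomial-descend v n (suc j) (k , le) = binomial-descend v n j (descend k le)
  where
  open ℕP.≤-Reasoning
  N = j ℕ.+ n
  descend : ∀ k → 2 ℕ.^ suc N ℕ.≤ v ℕ.* binomial (suc N) k → ∃[ k ] 2 ℕ.^ N ℕ.≤ v ℕ.* binomial N k
  descend zero    le = 0 , (begin
    2 ℕ.^ N                        ≤⟨ ℕP.m≤m+n _ _ ⟩
    2 ℕ.^ suc N                    ≤⟨ le ⟩
    v ℕ.* binomial (suc N) 0       ≡⟨ cong (v ℕ.*_) (trans (nC0≡1 (suc N)) (sym (nC0≡1 N))) ⟩
    v ℕ.* binomial N 0             ∎)
  descend (suc k) le with ℕP.≤-total (2 ℕ.^ N) (v ℕ.* binomial N k)
  ... | inj₁ p = k , p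
  ... | inj₂ p = suc k , ℕP.+-cancelˡ-≤ (2 ℕ.^ N) _ _ (begin
    2 ℕ.^ N ℕ.+ 2 ℕ.^ N                            ≡⟨ cong (2 ℕ.^ N ℕ.+_) (ℕP.+-identityʳ _) ⟨
    2 ℕ.^ suc N                                    ≤⟨ le ⟩
    v ℕ.* binomial (suc N) (suc k)                 ≡⟨ cong (v ℕ.*_) (nCk+nC[k+1]≡[n+1]C[k+1] N k) ⟨
    v ℕ.* (binomial N k ℕ.+ binomial N (suc k))    ≡⟨ ℕP.*-distribˡ-+ v _ _ ⟩
    v ℕ.* binomial N k ℕ.+ v ℕ.* binomial N (suc k) ≤⟨ ℕP.+-monoˡ-≤ _ p ⟩
    2 ℕ.^ N ℕ.+ v ℕ.* binomial N (suc k)           ∎)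

ℙ-count-pascal : ∀ d k → ℙ[count≡ suc k ] (suc d) ≡ ½ * (ℙ[count≡ suc k ] d + ℙ[count≡ k ] d)
ℙ-count-pascal d k = 𝔼-average (flips d) (λ cs → 𝟙 (count cs ℕ.≡ᵇ suc k)) (λ cs → 𝟙 (count cs ℕ.≡ᵇ k))

ℙ-count : ∀ d k → ℙ[count≡ k ] d * ι (2 ℕ.^ d) ≡ ι (binomial d k)
ℙ-count zero    zero    = refl
ℙ-count zero    (suc k) = refl
ℙ-count (suc d) zero    = begin
  ℙ[count≡ 0 ] (suc d) * ι (2 ℕ.^ suc d)                   ≡⟨ cong₂ _*_ (𝔼-average (flips d) (λ cs → 𝟙 (count cs ℕ.≡ᵇ 0)) (λ _ → 0ℚ)) (ι-* 2 (2 ℕ.^ d)) ⟩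
  ½ * (ℙ[count≡ 0 ] d + 𝔼 (flips d) (λ _ → 0ℚ)) * (2ℚ * ι (2 ℕ.^ d))
                                                           ≡⟨ cong (λ z → ½ * (ℙ[count≡ 0 ] d + z) * (2ℚ * ι (2 ℕ.^ d))) (𝔼-const (flips d) 0ℚ) ⟩
  ½ * (ℙ[count≡ 0 ] d + 0ℚ) * (2ℚ * ι (2 ℕ.^ d))           ≡⟨ identity (ℙ[count≡ 0 ] d) (ι (2 ℕ.^ d)) ⟩
  ℙ[count≡ 0 ] d * ι (2 ℕ.^ d)                             ≡⟨ ℙ-count d 0 ⟩
  ι (binomial d 0)                                         ≡⟨ cong ι (trans (nC0≡1 d) (sym (nC0≡1 (suc d)))) ⟩
  ι (binomial (suc d) 0)                                   ∎
  where
  open ≡-Reasoning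
  identity : ∀ p x → ½ * (p + 0ℚ) * (2ℚ * x) ≡ p * x
  identity = solve-∀ ℚ-ring
ℙ-count (suc d) (suc k) = begin
  ℙ[count≡ suc k ] (suc d) * ι (2 ℕ.^ suc d)               ≡⟨ cong₂ _*_ (ℙ-count-pascal d k) (ι-* 2 (2 ℕ.^ d)) ⟩
  ½ * (ℙ[count≡ suc k ] d + ℙ[count≡ k ] d) * (2ℚ * ι (2 ℕ.^ d))
                                                           ≡⟨ identity (ℙ[count≡ suc k ] d) (ℙ[count≡ k ] d) (ι (2 ℕ.^ d)) ⟩
  ℙ[count≡ k ] d * ι (2 ℕ.^ d) + ℙ[count≡ suc k ] d * ι (2 ℕ.^ d)
                                                           ≡⟨ cong₂ _+_ (ℙ-count d k) (ℙ-count d (suc k)) ⟩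
  ι (binomial d k) + ι (binomial d (suc k))                ≡⟨ ι-+ (binomial d k) (binomial d (suc k)) ⟨
  ι (binomial d k ℕ.+ binomial d (suc k))                  ≡⟨ cong ι (nCk+nC[k+1]≡[n+1]C[k+1] d k) ⟩
  ι (binomial (suc d) (suc k))                             ∎
  where
  open ≡-Reasoning
  identity : ∀ p q x → ½ * (p + q) * (2ℚ * x) ≡ q * x + p * x
  identity = solve-∀ ℚ-ring

-- The central entry of row 2h² is large, and descending by Pascal's rule keeps some entry large
-- down to row `d`. The index reached is not controlled, which is why the greedy rule must accept
-- any threshold.
ℙ-count-large : ∀ d h .{{_ : ℕ.NonZero h}} → d ℕ.≤ 2 ℕ.* (h ℕ.* h) → ∃[ k ] 1ℚ ≤ ι (2 ℕ.* h) * ℙ[count≡ k ] d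
ℙ-count-large d h d≤2h² with ℕP.m≤n⇒∃[o]m+o≡n d≤2h²
... | o , eq with binomial-descend (2 ℕ.* h) d o (h ℕ.* h ,
                    subst (λ n → 2 ℕ.^ n ℕ.≤ 2 ℕ.* h ℕ.* binomial n (h ℕ.* h)) (trans (sym eq) (ℕP.+-comm d o)) (central-square h))
...   | k , le = k , *-cancelʳ-≤ {ι (2 ℕ.^ d)} (0<ι (2 ℕ.^ d) {{ℕP.m^n≢0 2 d}}) (begin
  1ℚ * ι (2 ℕ.^ d)                                 ≡⟨ *-identityˡ _ ⟩
  ι (2 ℕ.^ d)                                      ≤⟨ ι-mono-≤ le ⟩
  ι (2 ℕ.* h ℕ.* binomial d k)                     ≡⟨ ι-* (2 ℕ.* h) (binomial d k) ⟩
  ι (2 ℕ.* h) * ι (binomial d k)                   ≡⟨ cong (ι (2 ℕ.* h) *_) (ℙ-count d k) ⟨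
  ι (2 ℕ.* h) * (ℙ[count≡ k ] d * ι (2 ℕ.^ d))     ≡⟨ *-assoc (ι (2 ℕ.* h)) (ℙ[count≡ k ] d) (ι (2 ℕ.^ d)) ⟨
  ι (2 ℕ.* h) * ℙ[count≡ k ] d * ι (2 ℕ.^ d)       ∎)
  where open ≤-Reasoning

-- The longest common subsequence as a random variable

Common : Str → List Str → Set
Common w Xs = All (w ⊆_) Xs

common? : ∀ w Xs → Dec (Common w Xs)
common? w Xs = All.all? (w ⊆?_) Xs

-- The local function step of LCS cannot be named from here; it is recovered by unification.
lcs-step : ∀ n Xs → ∃[ step ] LCS {2} n Xs ≡ List.foldr step 0 (stringsUpTo 2 n)
lcs-step n Xs = _ , refl

lcs-step-spec : ∀ n Xs w m → proj₁ (lcs-step n Xs) w m ≡ (if does (common? w Xs) then length w ℕ.⊔ m else m)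
lcs-step-spec n Xs w m with common? w Xs
... | yes _ = refl
... | no  _ = refl

longest : List Str → List Str → ℕ
longest Xs []       = 0
longest Xs (w ∷ ws) = if does (common? w Xs) then length w ℕ.⊔ longest Xs ws else longest Xs ws

LCS≡longest : ∀ n Xs → LCS n Xs ≡ longest Xs (stringsUpTo 2 n)
LCS≡longest n Xs = trans (proj₂ (lcs-step n Xs)) (go (stringsUpTo 2 n))
  where
  go : ∀ ws → List.foldr (proj₁ (lcs-step n Xs)) 0 ws ≡ longest Xs ws
  go []       = refl
  go (w ∷ ws) = trans (lcs-step-spec n Xs w _) (cong (λ m → if does (common? w Xs) then length w ℕ.⊔ m else m) (go ws))

longest-≥ : ∀ {w} Xs {ws} → w ∈ ws → Common w Xs → length w ℕ.≤ longest Xs ws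
longest-≥ {w} Xs {w ∷ ws} (here refl) p with common? w Xs
... | yes _ = ℕP.m≤m⊔n (length w) _
... | no ¬p = ⊥-elim (¬p p)
longest-≥ {w} Xs {v ∷ ws} (there w∈ws) p with does (common? v Xs)
... | true  = ℕP.≤-trans (longest-≥ Xs w∈ws p) (ℕP.m≤n⊔m (length v) _)
... | false = longest-≥ Xs w∈ws p

w∈strings : ∀ w → w ∈ strings 2 (length w)
w∈strings []      = here refl
w∈strings (c ∷ w) = ∈-concatMap⁺ (λ w → List.map (_∷ w) (allFin 2))
                      (Any.map (λ { refl → ∈-map⁺ (_∷ w) (∈-allFin c) }) (w∈strings w))

∈-stringsUpTo : ∀ n {w} → length w ℕ.≤ n → w ∈ stringsUpTo 2 n
∈-stringsUpTo zero    {[]} _  = here refl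
∈-stringsUpTo (suc n) {w} ∣w∣≤1+n with ℕP.m≤n⇒m<n∨m≡n ∣w∣≤1+n
... | inj₁ (s≤s ∣w∣≤n) = ∈-++⁺ʳ (strings 2 (suc n)) (∈-stringsUpTo n ∣w∣≤n)
... | inj₂ ∣w∣≡1+n     = ∈-++⁺ˡ (subst (λ k → w ∈ strings 2 k) ∣w∣≡1+n (w∈strings w))

LCS-≥ : ∀ n {w} Xs → length w ℕ.≤ n → Common w Xs → length w ℕ.≤ LCS n Xs
LCS-≥ n {w} Xs ∣w∣≤n p = subst (length w ℕ.≤_) (sym (LCS≡longest n Xs)) (longest-≥ Xs (∈-stringsUpTo n ∣w∣≤n) p)

sum-concatMap : ∀ {A B : Set} (f : B → ℕ) (g : A → List B) xs →
                sum (List.map f (concatMap g xs)) ≡ sum (List.map (λ x → sum (List.map f (g x))) xs)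
sum-concatMap f g []       = refl
sum-concatMap f g (x ∷ xs) = begin
  sum (List.map f (g x List.++ concatMap g xs))                  ≡⟨ cong sum (ListP.map-++ f (g x) (concatMap g xs)) ⟩
  sum (List.map f (g x) List.++ List.map f (concatMap g xs))     ≡⟨ SumP.sum-++ (List.map f (g x)) _ ⟩
  sum (List.map f (g x)) ℕ.+ sum (List.map f (concatMap g xs))   ≡⟨ cong (sum (List.map f (g x)) ℕ.+_) (sum-concatMap f g xs) ⟩
  sum (List.map (λ x → sum (List.map f (g x))) (x ∷ xs))         ∎
  where open ≡-Reasoning

sum-strings : ∀ n (f : Str → ℕ) → ι (sum (List.map f (strings 2 n))) ≡ ι (2 ℕ.^ n) * 𝔼 (word n) (ι ∘ f)
sum-strings zero    f = trans (cong ι (ℕP.+-identityʳ (f []))) (sym (*-identityˡ _))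
sum-strings (suc n) f = begin
  ι (sum (List.map f (strings 2 (suc n))))              ≡⟨ cong ι (sum-concatMap f (λ w → List.map (_∷ w) (allFin 2)) (strings 2 n)) ⟩
  ι (sum (List.map f′ (strings 2 n)))                   ≡⟨ sum-strings n f′ ⟩
  ι (2 ℕ.^ n) * 𝔼 (word n) (ι ∘ f′)                     ≡⟨ cong (ι (2 ℕ.^ n) *_) (trans (𝔼-cong (word n) split) (𝔼-* (word n) 2ℚ _)) ⟩
  ι (2 ℕ.^ n) * (2ℚ * 𝔼 (word (suc n)) (ι ∘ f))         ≡⟨ identity (ι (2 ℕ.^ n)) (𝔼 (word (suc n)) (ι ∘ f)) ⟩
  2ℚ * ι (2 ℕ.^ n) * 𝔼 (word (suc n)) (ι ∘ f)           ≡⟨ cong (_* 𝔼 (word (suc n)) (ι ∘ f)) (ι-* 2 (2 ℕ.^ n)) ⟨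
  ι (2 ℕ.^ suc n) * 𝔼 (word (suc n)) (ι ∘ f)            ∎
  where
  open ≡-Reasoning
  f′ : Str → ℕ
  f′ w = f (0b ∷ w) ℕ.+ (f (1b ∷ w) ℕ.+ 0)
  double : ∀ a b → a + b ≡ 2ℚ * (½ * (a + b))
  double = solve-∀ ℚ-ring
  identity : ∀ x y → x * (2ℚ * y) ≡ 2ℚ * x * y
  identity = solve-∀ ℚ-ring
  split : ∀ w → ι (f′ w) ≡ 2ℚ * 𝔼 coin (λ c → ι (f (c ∷ w)))
  split w = trans (cong ι (cong (f (0b ∷ w) ℕ.+_) (ℕP.+-identityʳ (f (1b ∷ w)))))
                  (trans (ι-+ (f (0b ∷ w)) (f (1b ∷ w))) (double (ι (f (0b ∷ w))) (ι (f (1b ∷ w)))))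

uniform : ∀ d n → Mean (Vec Str d)
uniform d n = words (Vec.replicate d n)

sum-tuples : ∀ n d (F : List Str → ℕ) →
             ι (sum (List.map F (tuples 2 n d))) ≡ ι (2 ℕ.^ (n ℕ.* d)) * 𝔼 (uniform d n) (ι ∘ F ∘ Vec.toList)
sum-tuples n zero    F rewrite ℕP.*-zeroʳ n = trans (cong ι (ℕP.+-identityʳ (F []))) (sym (*-identityˡ _))
sum-tuples n (suc d) F = begin
  ι (sum (List.map F (tuples 2 n (suc d))))
    ≡⟨ cong ι (sum-concatMap F (λ t → List.map (_∷ t) (strings 2 n)) (tuples 2 n d)) ⟩
  ι (sum (List.map (λ t → sum (List.map F (List.map (_∷ t) (strings 2 n)))) (tuples 2 n d)))
    ≡⟨ sum-tuples n d (λ t → sum (List.map F (List.map (_∷ t) (strings 2 n)))) ⟩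
  ι (2 ℕ.^ (n ℕ.* d)) * 𝔼 (uniform d n) (λ t → ι (sum (List.map F (List.map (_∷ Vec.toList t) (strings 2 n)))))
    ≡⟨ cong (ι (2 ℕ.^ (n ℕ.* d)) *_) (trans (𝔼-cong (uniform d n) inner) (𝔼-* (uniform d n) (ι (2 ℕ.^ n)) _)) ⟩
  ι (2 ℕ.^ (n ℕ.* d)) * (ι (2 ℕ.^ n) * 𝔼 (uniform (suc d) n) (ι ∘ F ∘ Vec.toList))
    ≡⟨ identity (ι (2 ℕ.^ (n ℕ.* d))) (ι (2 ℕ.^ n)) _ ⟩
  ι (2 ℕ.^ n) * ι (2 ℕ.^ (n ℕ.* d)) * 𝔼 (uniform (suc d) n) (ι ∘ F ∘ Vec.toList)
    ≡⟨ cong (_* 𝔼 (uniform (suc d) n) (ι ∘ F ∘ Vec.toList)) (trans (cong ι exponent) (ι-* (2 ℕ.^ n) (2 ℕ.^ (n ℕ.* d)))) ⟨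
  ι (2 ℕ.^ (n ℕ.* suc d)) * 𝔼 (uniform (suc d) n) (ι ∘ F ∘ Vec.toList)
    ∎
  where
  open ≡-Reasoning
  identity : ∀ x y z → x * (y * z) ≡ y * x * z
  identity = solve-∀ ℚ-ring
  exponent : 2 ℕ.^ (n ℕ.* suc d) ≡ 2 ℕ.^ n ℕ.* 2 ℕ.^ (n ℕ.* d)
  exponent = trans (cong (2 ℕ.^_) (ℕP.*-suc n d)) (ℕP.^-distribˡ-+-* 2 n (n ℕ.* d))
  inner : ∀ t → ι (sum (List.map F (List.map (_∷ Vec.toList t) (strings 2 n))))
                ≡ ι (2 ℕ.^ n) * 𝔼 (word n) (λ X → ι (F (X ∷ Vec.toList t)))
  inner t = trans (cong (ι ∘ sum) (sym (ListP.map-∘ (strings 2 n)))) (sum-strings n (λ X → F (X ∷ Vec.toList t)))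

𝔼LCS : ℕ → ℕ → ℚ
𝔼LCS d n = 𝔼 (uniform d n) (λ Xs → ι (LCS n (Vec.toList Xs)))

lcsRate*n : ∀ d n .{{_ : ℕ.NonZero n}} → lcsRate 2 d n * ι n ≡ 𝔼LCS d n
lcsRate*n d n@(suc _) = *-cancelʳ-≡ {ι q} (0<ι q {{ℕP.m^n≢0 2 (n ℕ.* d)}}) (begin
  lcsRate 2 d n * ι n * ι q           ≡⟨ *-assoc (lcsRate 2 d n) (ι n) (ι q) ⟩
  lcsRate 2 d n * (ι n * ι q)         ≡⟨ cong (lcsRate 2 d n *_) (ι-* n q) ⟨
  lcsRate 2 d n * ι (n ℕ.* q)         ≡⟨ /-*-ι _ (n ℕ.* q) {{ℕP.m*n≢0 n q {{_}} {{ℕP.m^n≢0 2 (n ℕ.* d)}}}} ⟩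
  ι (sum (List.map (LCS n) (tuples 2 n d)))   ≡⟨ sum-tuples n d (LCS n) ⟩
  ι q * 𝔼LCS d n                      ≡⟨ *-comm (ι q) (𝔼LCS d n) ⟩
  𝔼LCS d n * ι q                      ∎)
  where
  open ≡-Reasoning
  q = 2 ℕ.^ (n ℕ.* d)

-- Lower bound

Σ-replicate : ∀ d n r → Σᵥ (Vec.map (r ^_) (Vec.replicate d n)) ≡ ι d * r ^ n
Σ-replicate zero    n r = sym (*-zeroˡ (r ^ n))
Σ-replicate (suc d) n r = begin
  r ^ n + Σᵥ (Vec.map (r ^_) (Vec.replicate d n))   ≡⟨ cong (_+_ (r ^ n)) (Σ-replicate d n r) ⟩
  r ^ n + ι d * r ^ n                               ≡⟨ identity (ι d) (r ^ n) ⟩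
  (1ℚ + ι d) * r ^ n                                ≡⟨ cong (_* r ^ n) (ι-+ 1 d) ⟨
  ι (suc d) * r ^ n                                 ∎
  where
  open ≡-Reasoning
  identity : ∀ x y → y + x * y ≡ (1ℚ + x) * y
  identity = solve-∀ ℚ-ring

toList-All : ∀ {A : Set} {P : A → Set} {d} {xs : Vec A d} → VAll.All P xs → All P (Vec.toList xs)
toList-All VAll.[]       = []
toList-All (p VAll.∷ ps) = p ∷ toList-All ps

LCS-greedy : ∀ {d} k {m n} → m ℕ.≤ n → (Xs : Vec Str d) → ι m + (- ι m) * bad k m Xs ≤ ι (LCS n (Vec.toList Xs))
LCS-greedy k {m} {n} m≤n Xs with bad-split k m Xs
... | inj₁ eq = begin
  ι m + (- ι m) * bad k m Xs   ≡⟨ cong (λ z → ι m + (- ι m) * z) eq ⟩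
  ι m + (- ι m) * 1ℚ           ≡⟨ cancel (ι m) ⟩
  0ℚ                           ≤⟨ 0≤ι _ ⟩
  ι (LCS n (Vec.toList Xs))    ∎
  where
  open ≤-Reasoning
  cancel : ∀ x → x + (- x) * 1ℚ ≡ 0ℚ
  cancel = solve-∀ ℚ-ring
... | inj₂ (eq , w , refl , p) = begin
  ι m + (- ι m) * bad k m Xs   ≡⟨ cong (λ z → ι m + (- ι m) * z) eq ⟩
  ι m + (- ι m) * 0ℚ           ≡⟨ cancel (ι m) ⟩
  ι m                          ≤⟨ ι-mono-≤ (LCS-≥ n (Vec.toList Xs) m≤n (toList-All p)) ⟩
  ι (LCS n (Vec.toList Xs))    ∎
  where
  open ≤-Reasoning
  cancel : ∀ x → x + (- x) * 0ℚ ≡ x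
  cancel = solve-∀ ℚ-ring

𝔼LCS-greedy : ∀ d k {m n σ} → m ℕ.≤ n → 𝔼 (uniform d n) (bad k m) ≤ σ → ι m * (1ℚ - σ) ≤ 𝔼LCS d n
𝔼LCS-greedy d k {m} {n} {σ} m≤n 𝔼bad≤σ = begin
  ι m * (1ℚ - σ)                                           ≤⟨ *-monoˡ (ι m) (0≤ι m) (+-monoʳ-≤ 1ℚ (neg-antimono-≤ 𝔼bad≤σ)) ⟩
  ι m * (1ℚ - 𝔼 U (bad k m))                               ≡⟨ identity (ι m) (𝔼 U (bad k m)) ⟩
  ι m + (- ι m) * 𝔼 U (bad k m)                            ≡⟨ cong₂ _+_ (𝔼-const U (ι m)) (𝔼-* U (- ι m) (bad k m)) ⟨
  𝔼 U (λ _ → ι m) + 𝔼 U (λ Xs → (- ι m) * bad k m Xs)      ≡⟨ 𝔼-+ U (λ _ → ι m) (λ Xs → (- ι m) * bad k m Xs) ⟨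
  𝔼 U (λ Xs → ι m + (- ι m) * bad k m Xs)                  ≤⟨ 𝔼-mono U (LCS-greedy k m≤n) ⟩
  𝔼LCS d n                                                 ∎
  where
  open ≤-Reasoning
  U = uniform d n
  identity : ∀ x y → x * (1ℚ - y) ≡ x + (- x) * y
  identity = solve-∀ ℚ-ring

-- Second-order estimates for the exponential moment of a round

0≤-literal : ∀ n d .{{_ : ℕ.NonZero d}} → 0ℚ ≤ + n / d
0≤-literal n d = nonNegative⁻¹ (+ n / d) {{normalize-nonNeg n d}}

0≤[1-ce] : ∀ c {e} → 0ℚ ≤ c → 0ℚ ≤ e → e * (+ 20 / 1) ≤ 1ℚ → c ≤ + 20 / 1 → 0ℚ ≤ 1ℚ - e * c
0≤[1-ce] c {e} 0≤c 0≤e e*20≤1 c≤20 = ≤⇒0≤- (≤-trans (*-monoˡ e 0≤e c≤20) e*20≤1)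

-- κ and M are polynomial upper bounds for 1/(1 - 2e) and for the exponential moment of one round, so
-- that no division is needed.
module Rates (L : ℕ) (e : ℚ) (0≤e : 0ℚ ≤ e) (e*20≤1 : e * (+ 20 / 1) ≤ 1ℚ) (eL≡1 : e * ι L ≡ 1ℚ) where

  r κ M : ℚ
  r = 1ℚ - e
  κ = 1ℚ + (2ℚ * e + 8ℚ * (e * e))
  M = 1ℚ + (2ℚ * e - 4ℚ * (e * e))

  private
    0≤e² : 0ℚ ≤ e * e
    0≤e² = 0≤* 0≤e 0≤e
    0≤2 : 0ℚ ≤ 2ℚ
    0≤2 = 0≤-literal 2 1
    0≤1-ce : ∀ n → n ℕ.≤ 20 → 0ℚ ≤ 1ℚ - e * ι n
    0≤1-ce n n≤20 = 0≤[1-ce] (ι n) (0≤ι n) 0≤e e*20≤1 (ι-mono-≤ n≤20)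

  e≤1 : e ≤ 1ℚ
  e≤1 = ≤-by (1ℚ - e * ι 1) (0≤1-ce 1 (s≤s z≤n)) (identity e)
    where
    identity : ∀ e → e + (1ℚ - e * ι 1) ≡ 1ℚ
    identity = solve-∀ ℚ-ring

  0≤r : 0ℚ ≤ r
  0≤r = ≤⇒0≤- e≤1

  r≤1 : r ≤ 1ℚ
  r≤1 = ≤-by e 0≤e (identity e)
    where
    identity : ∀ e → 1ℚ - e + e ≡ 1ℚ
    identity = solve-∀ ℚ-ring

  0<r : 0ℚ < r
  0<r = <-≤-trans (toWitness {a? = 0ℚ <? + 19 / 20} _) (≤-by ((1ℚ - e * (+ 20 / 1)) * (+ 1 / 20)) (0≤* (≤⇒0≤- e*20≤1) (0≤-literal 1 20)) (identity e))
    where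
    identity : ∀ e → + 19 / 20 + (1ℚ - e * (+ 20 / 1)) * (+ 1 / 20) ≡ 1ℚ - e
    identity = solve-∀ ℚ-ring

  1≤κ : 1ℚ ≤ κ
  1≤κ = ≤-by _ (0≤+ (0≤* 0≤2 0≤e) (0≤* (0≤-literal 8 1) 0≤e²)) refl

  wait : ½ * (1ℚ + κ) ≤ κ * r
  wait = ≤-by (2ℚ * (e * e) * (1ℚ - e * ι 4)) (0≤* (0≤* 0≤2 0≤e²) (0≤1-ce 4 (ℕP.m≤m+n 4 16))) (identity e)
    where
    identity : ∀ e → ½ * (1ℚ + (1ℚ + (2ℚ * e + 8ℚ * (e * e)))) + 2ℚ * (e * e) * (1ℚ - e * ι 4)
                     ≡ (1ℚ + (2ℚ * e + 8ℚ * (e * e))) * (1ℚ - e)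
    identity = solve-∀ ℚ-ring

  1≤M : 1ℚ ≤ M
  1≤M = ≤-by (2ℚ * e * (1ℚ - e * ι 2)) (0≤* (0≤* 0≤2 0≤e) (0≤1-ce 2 (ℕP.m≤m+n 2 18))) (identity e)
    where
    identity : ∀ e → 1ℚ + 2ℚ * e * (1ℚ - e * ι 2) ≡ 1ℚ + (2ℚ * e - 4ℚ * (e * e))
    identity = solve-∀ ℚ-ring

  -- Without ties the left side times `r` is 1 + 3e² up to third order. A tie probability of 10e
  -- subtracts 10e², so the balance becomes -7e², with room for the higher-order terms.
  round : ∀ {p} → e * ι 10 ≤ p → ½ * (1ℚ + κ) + (- (½ * (κ - 1ℚ))) * p ≤ M * r
  round {p} 10e≤p = ≤-by ((e + 4ℚ * (e * e)) * (p - e * ι 10) + ι 44 * (e * (e * e)))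
    (0≤+ (0≤* (0≤+ 0≤e (0≤* (0≤-literal 4 1) 0≤e²)) (≤⇒0≤- 10e≤p)) (0≤* (0≤ι 44) (0≤* 0≤e 0≤e²)))
    (identity e p)
    where
    identity : ∀ e p → ½ * (1ℚ + (1ℚ + (2ℚ * e + 8ℚ * (e * e)))) + (- (½ * ((1ℚ + (2ℚ * e + 8ℚ * (e * e))) - 1ℚ))) * p
                         + ((e + 4ℚ * (e * e)) * (p - e * ι 10) + ι 44 * (e * (e * e)))
                       ≡ (1ℚ + (2ℚ * e - 4ℚ * (e * e))) * (1ℚ - e)
    identity = solve-∀ ℚ-ring

  0≤4e² : 0ℚ ≤ 4ℚ * (e * e)
  0≤4e² = 0≤* (0≤-literal 4 1) 0≤e²

  Mr²≤1-4e² : M * (r * r) ≤ 1ℚ - 4ℚ * (e * e)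
  Mr²≤1-4e² = ≤-by (e * e * (2ℚ + (1ℚ - e * ι 10)) + 4ℚ * (e * e * (e * e)))
    (0≤+ (0≤* 0≤e² (0≤+ 0≤2 (0≤1-ce 10 (ℕP.m≤m+n 10 10)))) (0≤* (0≤-literal 4 1) (0≤* 0≤e² 0≤e²)))
    (identity e)
    where
    identity : ∀ e → (1ℚ + (2ℚ * e - 4ℚ * (e * e))) * ((1ℚ - e) * (1ℚ - e))
                       + (e * e * (2ℚ + (1ℚ - e * ι 10)) + 4ℚ * (e * e * (e * e)))
                     ≡ 1ℚ - 4ℚ * (e * e)
    identity = solve-∀ ℚ-ring

  4e²≤1 : 4ℚ * (e * e) ≤ 1ℚ
  4e²≤1 = ≤-by ((1ℚ - e * ι 2) * (1ℚ + 2ℚ * e)) (0≤* (0≤1-ce 2 (ℕP.m≤m+n 2 18)) (0≤+ 0≤1 (0≤* 0≤2 0≤e))) (identity e)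
    where
    identity : ∀ e → 4ℚ * (e * e) + (1ℚ - e * ι 2) * (1ℚ + 2ℚ * e) ≡ 1ℚ
    identity = solve-∀ ℚ-ring

  -- Since L = 1/e, the power is at most 1/(1 + 4e), which is below 1 - e. In exponential weight,
  -- `L` rounds thus consume one letter less than 2L.
  [Mr²]^L≤r : (M * (r * r)) ^ L ≤ r
  [Mr²]^L≤r = ≤-trans (^-monoˡ-≤ L (0≤* (≤-trans 0≤1 1≤M) (0≤* 0≤r 0≤r)) Mr²≤1-4e²) (begin
    p                                     ≤⟨ ≤-by (p * (e * (2ℚ + (1ℚ - e * ι 4)))) (0≤* 0≤p (0≤* 0≤e (0≤+ 0≤2 (0≤1-ce 4 (ℕP.m≤m+n 4 16))))) (identity p e) ⟩
    p * (1ℚ + 4ℚ * e * 1ℚ) * r            ≡⟨ cong (λ z → p * (1ℚ + 4ℚ * e * z) * r) eL≡1 ⟨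
    p * (1ℚ + 4ℚ * e * (e * ι L)) * r     ≡⟨ cong (λ z → p * (1ℚ + z) * r) (commute e (ι L)) ⟩
    p * (1ℚ + ι L * (4ℚ * (e * e))) * r   ≤⟨ *-monoʳ r 0≤r (inverse-bernoulli L 0≤4e² 4e²≤1) ⟩
    1ℚ * r                                ≡⟨ *-identityˡ r ⟩
    r                                     ∎)
    where
    open ≤-Reasoning
    p = (1ℚ - 4ℚ * (e * e)) ^ L
    0≤p = 0≤^ L (≤⇒0≤- 4e²≤1)
    identity : ∀ p e → p + p * (e * (2ℚ + (1ℚ - e * ι 4))) ≡ p * (1ℚ + 4ℚ * e * 1ℚ) * (1ℚ - e)
    identity = solve-∀ ℚ-ring
    commute : ∀ e l → 4ℚ * e * (e * l) ≡ l * (4ℚ * (e * e))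
    commute = solve-∀ ℚ-ring

  M^Lj*r^2Lj≤r^j : ∀ j → M ^ (L ℕ.* j) * r ^ (2 ℕ.* (L ℕ.* j)) ≤ r ^ j
  M^Lj*r^2Lj≤r^j j = begin
    M ^ (L ℕ.* j) * r ^ (2 ℕ.* (L ℕ.* j))       ≡⟨ cong (M ^ (L ℕ.* j) *_) (trans (cong (λ z → r ^ (L ℕ.* j ℕ.+ z)) (ℕP.+-identityʳ (L ℕ.* j))) (^-homo-* r (L ℕ.* j) (L ℕ.* j))) ⟩
    M ^ (L ℕ.* j) * (r ^ (L ℕ.* j) * r ^ (L ℕ.* j)) ≡⟨ cong (M ^ (L ℕ.* j) *_) (^-distrib-* r r (L ℕ.* j)) ⟨
    M ^ (L ℕ.* j) * (r * r) ^ (L ℕ.* j)         ≡⟨ ^-distrib-* M (r * r) (L ℕ.* j) ⟨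
    (M * (r * r)) ^ (L ℕ.* j)                   ≡⟨ ^-assocʳ (M * (r * r)) L j ⟨
    ((M * (r * r)) ^ L) ^ j                     ≤⟨ ^-monoˡ-≤ j (0≤^ L (0≤* (≤-trans 0≤1 1≤M) (0≤* 0≤r 0≤r))) [Mr²]^L≤r ⟩
    r ^ j                                       ∎
    where open ≤-Reasoning

  0<^ : ∀ n → 0ℚ < r ^ n
  0<^ zero    = 0<ι 1
  0<^ (suc n) = subst (_< r * r ^ n) (*-zeroʳ r) (*-monoʳ-<-pos r {{positive 0<r}} (0<^ n))

  -- L j rounds are charged 2 L j - j letters, and the `s` letters left over become the decay.
  -- Multiplying through by r^j avoids the subtraction.
  M^Lj*r^n≤r^s : ∀ j n s → 2 ℕ.* (L ℕ.* j) ℕ.+ s ℕ.≤ n ℕ.+ j → M ^ (L ℕ.* j) * r ^ n ≤ r ^ s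
  M^Lj*r^n≤r^s j n s le = *-cancelʳ-≤ (0<^ j) (begin
    M ^ (L ℕ.* j) * r ^ n * r ^ j                       ≡⟨ trans (*-assoc (M ^ (L ℕ.* j)) (r ^ n) (r ^ j)) (cong (M ^ (L ℕ.* j) *_) (sym (^-homo-* r n j))) ⟩
    M ^ (L ℕ.* j) * r ^ (n ℕ.+ j)                       ≤⟨ *-monoˡ (M ^ (L ℕ.* j)) (0≤^ (L ℕ.* j) (≤-trans 0≤1 1≤M)) (^-antitoneʳ 0≤r r≤1 le) ⟩
    M ^ (L ℕ.* j) * r ^ (2 ℕ.* (L ℕ.* j) ℕ.+ s)         ≡⟨ trans (cong (M ^ (L ℕ.* j) *_) (^-homo-* r (2 ℕ.* (L ℕ.* j)) s)) (sym (*-assoc (M ^ (L ℕ.* j)) _ (r ^ s))) ⟩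
    M ^ (L ℕ.* j) * r ^ (2 ℕ.* (L ℕ.* j)) * r ^ s       ≤⟨ *-monoʳ (r ^ s) (0≤^ s 0≤r) (M^Lj*r^2Lj≤r^j j) ⟩
    r ^ j * r ^ s                                       ≡⟨ *-comm (r ^ j) (r ^ s) ⟩
    r ^ s * r ^ j                                       ∎)
    where open ≤-Reasoning

  r^a-small : ∀ a D → L ℕ.* D ℕ.≤ a → ι D * r ^ a ≤ 1ℚ
  r^a-small a D LD≤a = begin
    ι D * r ^ a               ≡⟨ *-comm (ι D) (r ^ a) ⟩
    r ^ a * ι D               ≤⟨ *-monoˡ (r ^ a) (0≤^ a 0≤r) D≤1+ae ⟩
    r ^ a * (1ℚ + ι a * e)    ≤⟨ inverse-bernoulli a 0≤e e≤1 ⟩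
    1ℚ                        ∎
    where
    open ≤-Reasoning
    identity : ∀ e l D → e * l * D ≡ l * D * e
    identity = solve-∀ ℚ-ring
    D≤1+ae : ι D ≤ 1ℚ + ι a * e
    D≤1+ae = begin
      ι D                   ≡⟨ *-identityˡ (ι D) ⟨
      1ℚ * ι D              ≡⟨ cong (_* ι D) eL≡1 ⟨
      e * ι L * ι D         ≡⟨ identity e (ι L) (ι D) ⟩
      ι L * ι D * e         ≡⟨ cong (_* e) (ι-* L D) ⟨
      ι (L ℕ.* D) * e       ≤⟨ *-monoʳ e 0≤e (ι-mono-≤ LD≤a) ⟩
      ι a * e               ≤⟨ ≤-by 1ℚ 0≤1 (+-comm (ι a * e) 1ℚ) ⟩
      1ℚ + ι a * e          ∎

  open Greedy r κ 0≤r 1≤κ wait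

  -- a is the quotient of n by 4L - 1; m = 2La greedy rounds fit into n letters with room to spare.
  module _ (d k n a : ℕ) (10e≤ℙ : e * ι 10 ≤ ℙ[count≡ k ] d)
           (n-lower : 4 ℕ.* L ℕ.* a ℕ.≤ n ℕ.+ a) (n-upper : n ℕ.+ suc a ℕ.≤ 4 ℕ.* L ℕ.* suc a)
           (a-large : L ℕ.* (16 ℕ.* L ℕ.* suc d) ℕ.≤ a) .{{_ : ℕ.NonZero L}} where

    private
      -- The m = 2La rounds save 2a letters against 2 per round. One a is kept as the margin behind
      -- r^a, the other makes m exceed n/2; the factor d+1 sums over the strings.
      σ = ι (suc d) * r ^ a
      m = L ℕ.* (2 ℕ.* a)

    𝔼-bad-uniform : 𝔼 (uniform (suc d) n) (bad k m) ≤ σ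
    𝔼-bad-uniform = begin
      𝔼 (uniform (suc d) n) (bad k m)                 ≤⟨ 𝔼-bad k M 1≤M (round 10e≤ℙ) m (Vec.replicate (suc d) n) ⟩
      M ^ m * Σᵥ (Vec.map (r ^_) (Vec.replicate (suc d) n))
                                                      ≡⟨ cong (M ^ m *_) (Σ-replicate (suc d) n r) ⟩
      M ^ m * (ι (suc d) * r ^ n)                     ≡⟨ swap (M ^ m) (ι (suc d)) (r ^ n) ⟩
      ι (suc d) * (M ^ m * r ^ n)                     ≤⟨ *-monoˡ (ι (suc d)) (0≤ι (suc d)) (M^Lj*r^n≤r^s (2 ℕ.* a) n a room) ⟩
      σ                                               ∎
      where
      open ≤-Reasoning
      swap : ∀ x y z → x * (y * z) ≡ y * (x * z)
      swap = solve-∀ ℚ-ring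
      shape : ∀ L a → 2 ℕ.* (L ℕ.* (2 ℕ.* a)) ℕ.+ a ≡ 4 ℕ.* L ℕ.* a ℕ.+ a
      shape = ℕSolver.solve-∀
      shape′ : ∀ n a → n ℕ.+ a ℕ.+ a ≡ n ℕ.+ 2 ℕ.* a
      shape′ = ℕSolver.solve-∀
      room : 2 ℕ.* (L ℕ.* (2 ℕ.* a)) ℕ.+ a ℕ.≤ n ℕ.+ 2 ℕ.* a
      room = subst₂ ℕ._≤_ (sym (shape L a)) (shape′ n a) (ℕP.+-monoˡ-≤ a n-lower)

    m≤n : m ℕ.≤ n
    m≤n = ℕP.+-cancelʳ-≤ a m n (ℕP.≤-trans (ℕP.+-monoʳ-≤ m a≤m) (ℕP.≤-trans (ℕP.≤-reflexive (shape L a)) n-lower))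
      where
      shape : ∀ L a → L ℕ.* (2 ℕ.* a) ℕ.+ L ℕ.* (2 ℕ.* a) ≡ 4 ℕ.* L ℕ.* a
      shape = ℕSolver.solve-∀
      a≤m : a ℕ.≤ m
      a≤m = ℕP.≤-trans (ℕP.m≤m+n a (a ℕ.+ 0)) (ℕP.m≤n*m (2 ℕ.* a) L)

    -- As n is about (4L - 1)a, m exceeds n/2 by about a/2, that is, n e/8. Half of this is kept as
    -- n e/16. Of the rest, a/8 covers the failure loss m σ (from 16 L σ ≤ 1) and a/8 the rounding
    -- of n to a multiple of 4L - 1 (from 16 L ≤ a).
    𝔼LCS-lower : ι n * (½ + e * (+ 1 / 16)) ≤ 𝔼LCS (suc d) n
    𝔼LCS-lower = begin
      x * (½ + e * (+ 1 / 16))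
        ≤⟨ *-monoʳ (½ + e * (+ 1 / 16)) (0≤+ (0≤-literal 1 2) (0≤* 0≤e (0≤-literal 1 16))) x≤ ⟩
      (4ℚ * l - 1ℚ) * (1ℚ + A) * (½ + e * (+ 1 / 16))
        ≡⟨ expand l A e ⟩
      (1ℚ + A) * (2ℚ * l - ½ + (+ 1 / 4) * (e * l) - e * (+ 1 / 16))
        ≡⟨ cong (λ z → (1ℚ + A) * (2ℚ * l - ½ + (+ 1 / 4) * z - e * (+ 1 / 16))) eL≡1 ⟩
      (1ℚ + A) * (2ℚ * l - ½ + (+ 1 / 4) * 1ℚ - e * (+ 1 / 16))
        ≤⟨ ≤-by (A * (1ℚ - ι 16 * l * σ) * (+ 1 / 8) + (A - ι 16 * l) * (+ 1 / 8) + (+ 1 / 4) + (1ℚ + A) * e * (+ 1 / 16))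
             (0≤+ (0≤+ (0≤+ (0≤* (0≤* (0≤ι a) (≤⇒0≤- 16lσ≤1)) (0≤-literal 1 8))
                            (0≤* (≤⇒0≤- 16l≤A) (0≤-literal 1 8)))
                       (0≤-literal 1 4))
                  (0≤* (0≤* (0≤+ 0≤1 (0≤ι a)) 0≤e) (0≤-literal 1 16)))
             (balance l A e σ) ⟩
      l * (2ℚ * A) * (1ℚ - σ)
        ≡⟨ cong (_* (1ℚ - σ)) (trans (ι-* L (2 ℕ.* a)) (cong (ι L *_) (ι-* 2 a))) ⟨
      ι m * (1ℚ - σ)
        ≤⟨ 𝔼LCS-greedy (suc d) k m≤n 𝔼-bad-uniform ⟩
      𝔼LCS (suc d) n
        ∎
      where
      open ≤-Reasoning
      x = ι n
      l = ι L
      A = ι a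
      expand : ∀ l A e → (4ℚ * l - 1ℚ) * (1ℚ + A) * (½ + e * (+ 1 / 16))
               ≡ (1ℚ + A) * (2ℚ * l - ½ + (+ 1 / 4) * (e * l) - e * (+ 1 / 16))
      expand = solve-∀ ℚ-ring
      balance : ∀ l A e σ → (1ℚ + A) * (2ℚ * l - ½ + (+ 1 / 4) * 1ℚ - e * (+ 1 / 16))
                  + (A * (1ℚ - ι 16 * l * σ) * (+ 1 / 8) + (A - ι 16 * l) * (+ 1 / 8) + (+ 1 / 4) + (1ℚ + A) * e * (+ 1 / 16))
                ≡ l * (2ℚ * A) * (1ℚ - σ)
      balance = solve-∀ ℚ-ring
      x≤ : x ≤ (4ℚ * l - 1ℚ) * (1ℚ + A)
      x≤ = begin
        x                                                 ≡⟨ isolate x (1ℚ + A) ⟩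
        x + (1ℚ + A) - (1ℚ + A)                           ≡⟨ cong (_- (1ℚ + A)) (trans (ι-+ n (suc a)) (cong (_+_ x) (ι-+ 1 a))) ⟨
        ι (n ℕ.+ suc a) - (1ℚ + A)                        ≤⟨ +-monoˡ-≤ (- (1ℚ + A)) (ι-mono-≤ n-upper) ⟩
        ι (4 ℕ.* L ℕ.* suc a) - (1ℚ + A)                  ≡⟨ cong (_- (1ℚ + A)) (trans (ι-* (4 ℕ.* L) (suc a)) (cong₂ _*_ (ι-* 4 L) (ι-+ 1 a))) ⟩
        4ℚ * l * (1ℚ + A) - (1ℚ + A)                      ≡⟨ collect l (1ℚ + A) ⟩
        (4ℚ * l - 1ℚ) * (1ℚ + A)                          ∎
        where
        isolate : ∀ x y → x ≡ x + y - y
        isolate = solve-∀ ℚ-ring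
        collect : ∀ l y → 4ℚ * l * y - y ≡ (4ℚ * l - 1ℚ) * y
        collect = solve-∀ ℚ-ring
      16lσ≤1 : ι 16 * l * σ ≤ 1ℚ
      16lσ≤1 = subst (_≤ 1ℚ)
        (trans (cong (_* r ^ a) (trans (ι-* (16 ℕ.* L) (suc d)) (cong (_* ι (suc d)) (ι-* 16 L))))
               (*-assoc (ι 16 * l) (ι (suc d)) (r ^ a)))
        (r^a-small a (16 ℕ.* L ℕ.* suc d) a-large)
      16l≤A : ι 16 * l ≤ A
      16l≤A = subst (_≤ A) (ι-* 16 L) (ι-mono-≤ (ℕP.≤-trans (ℕP.m≤m*n (16 ℕ.* L) (suc d))
                (ℕP.≤-trans (ℕP.m≤n*m (16 ℕ.* L ℕ.* suc d) L) a-large)))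

-- The integer stand-in for √d. The root is raised only when its successor fits; otherwise d lies
-- below the next square, which is at most four times the present one.
sqrt-bounds : ∀ d → ∃[ h ] (suc h ℕ.* suc h ℕ.≤ suc d × suc d ℕ.≤ 4 ℕ.* (suc h ℕ.* suc h))
sqrt-bounds zero    = 0 , ℕP.≤-refl , s≤s z≤n
sqrt-bounds (suc d) with sqrt-bounds d
... | h , h²≤d , d≤4h² with ℕP.≤-<-connex ((2 ℕ.+ h) ℕ.* (2 ℕ.+ h)) (2 ℕ.+ d)
...   | inj₁ ≤d = suc h , ≤d , (begin
  2 ℕ.+ d                                        ≤⟨ s≤s d≤4h² ⟩
  suc (4 ℕ.* (suc h ℕ.* suc h))                  ≤⟨ ℕP.m≤m+n _ (11 ℕ.+ 8 ℕ.* h) ⟩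
  suc (4 ℕ.* (suc h ℕ.* suc h)) ℕ.+ (11 ℕ.+ 8 ℕ.* h) ≡⟨ identity h ⟩
  4 ℕ.* ((2 ℕ.+ h) ℕ.* (2 ℕ.+ h))                ∎)
  where
  open ℕP.≤-Reasoning
  identity : ∀ h → 1 ℕ.+ 4 ℕ.* ((1 ℕ.+ h) ℕ.* (1 ℕ.+ h)) ℕ.+ (11 ℕ.+ 8 ℕ.* h) ≡ 4 ℕ.* ((2 ℕ.+ h) ℕ.* (2 ℕ.+ h))
  identity = ℕSolver.solve-∀
...   | inj₂ d< = h , ℕP.m≤n⇒m≤1+n h²≤d , (begin
  2 ℕ.+ d                                        ≤⟨ ℕP.<⇒≤ d< ⟩
  (2 ℕ.+ h) ℕ.* (2 ℕ.+ h)                        ≤⟨ ℕP.m≤m+n _ (3 ℕ.* (h ℕ.* h) ℕ.+ 4 ℕ.* h) ⟩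
  (2 ℕ.+ h) ℕ.* (2 ℕ.+ h) ℕ.+ (3 ℕ.* (h ℕ.* h) ℕ.+ 4 ℕ.* h) ≡⟨ identity h ⟩
  4 ℕ.* (suc h ℕ.* suc h)                        ∎)
  where
  open ℕP.≤-Reasoning
  identity : ∀ h → (2 ℕ.+ h) ℕ.* (2 ℕ.+ h) ℕ.+ (3 ℕ.* (h ℕ.* h) ℕ.+ 4 ℕ.* h) ≡ 4 ℕ.* ((1 ℕ.+ h) ℕ.* (1 ℕ.+ h))
  identity = ℕSolver.solve-∀

0<1/ : ∀ n .{{_ : ℕ.NonZero n}} → 0ℚ < + 1 / n
0<1/ n = positive⁻¹ (+ 1 / n) {{normalize-pos 1 n}}

-- Any positive value below 1/640 = (e/16) h would serve, where e = 1/(40h).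
c₁ : ℚ
c₁ = + 1 / 1000

gtHalfPlus : ∀ {x v} d h → 0ℚ < v → ½ + v ≤ x → v * ι h ≡ + 1 / 640 → h ℕ.* h ℕ.≤ d → GtHalfPlus x c₁ d
gtHalfPlus {x} {v} d h 0<v ½+v≤x vh≡ h²≤d = ½<x , (begin-strict
  c₁ * c₁                              <⟨ toWitness {a? = c₁ * c₁ <? (+ 1 / 640) * (+ 1 / 640)} _ ⟩
  (+ 1 / 640) * (+ 1 / 640)            ≡⟨ cong₂ _*_ vh≡ vh≡ ⟨
  v * ι h * (v * ι h)                  ≡⟨ identity v (ι h) ⟩
  v * v * (ι h * ι h)                  ≡⟨ cong (v * v *_) (ι-* h h) ⟨
  v * v * ι (h ℕ.* h)                  ≤⟨ *-mono (0≤* 0≤v 0≤v) (0≤ι d) (*-mono 0≤v (≤-trans 0≤v v≤x-½) v≤x-½ v≤x-½) (ι-mono-≤ h²≤d) ⟩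
  (x - ½) * (x - ½) * ι d              ≡⟨ cong ((x - ½) * (x - ½) *_) (/1≡ι d) ⟨
  (x - ½) * (x - ½) * (+ d / 1)        ∎)
  where
  open ≤-Reasoning
  0≤v = <⇒≤ 0<v
  ½<x : ½ < x
  ½<x = <-≤-trans (subst (_< ½ + v) (+-identityʳ ½) (+-monoʳ-< ½ 0<v)) ½+v≤x
  isolate : ∀ v → v ≡ ½ + v - ½
  isolate = solve-∀ ℚ-ring
  v≤x-½ : v ≤ x - ½
  v≤x-½ = subst (_≤ x - ½) (sym (isolate v)) (+-monoˡ-≤ (- ½) ½+v≤x)
  identity : ∀ v h → v * h * (v * h) ≡ v * v * (h * h)
  identity = solve-∀ ℚ-ring

-- With h ≈ √d and e = 1/(40h), the greedy rate exceeds 1/2 by e/16.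
module Lower (d h L q : ℕ) (e : ℚ) .{{_ : ℕ.NonZero h}} .{{_ : ℕ.NonZero L}} .{{_ : ℕ.NonZero q}}
             (h²≤d : h ℕ.* h ℕ.≤ suc d) (d≤4h² : suc d ℕ.≤ 4 ℕ.* (h ℕ.* h))
             (L≡40h : L ≡ 20 ℕ.* (2 ℕ.* h)) (1+q≡4L : suc q ≡ 4 ℕ.* L)
             (0<e : 0ℚ < e) (eL≡1 : e * ι L ≡ 1ℚ) where

  private
    H = 2 ℕ.* h
    instance
      H≢0 : ℕ.NonZero H
      H≢0 = ℕP.m*n≢0 2 h

    0≤e : 0ℚ ≤ e
    0≤e = <⇒≤ 0<e

    e*20≤1 : e * (+ 20 / 1) ≤ 1ℚ
    e*20≤1 = subst (e * ι 20 ≤_) eL≡1 (*-monoˡ e 0≤e (ι-mono-≤ (subst (20 ℕ.≤_) (sym L≡40h) (ℕP.m≤m*n 20 H))))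

    open Rates L e 0≤e e*20≤1 eL≡1

    4h²≤2H² : 4 ℕ.* (h ℕ.* h) ℕ.≤ 2 ℕ.* (H ℕ.* H)
    4h²≤2H² = subst (4 ℕ.* (h ℕ.* h) ℕ.≤_) (identity h) (ℕP.m≤m+n (4 ℕ.* (h ℕ.* h)) (4 ℕ.* (h ℕ.* h)))
      where
      identity : ∀ h → 4 ℕ.* (h ℕ.* h) ℕ.+ 4 ℕ.* (h ℕ.* h) ≡ 2 ℕ.* (2 ℕ.* h ℕ.* (2 ℕ.* h))
      identity = ℕSolver.solve-∀

    likely-tie : ∃[ k ] 1ℚ ≤ ι (2 ℕ.* H) * ℙ[count≡ k ] d
    likely-tie = ℙ-count-large d H (ℕP.≤-trans (ℕP.n≤1+n d) (ℕP.≤-trans d≤4h² 4h²≤2H²))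

    k = proj₁ likely-tie
    1≤2Hℙ = proj₂ likely-tie

    -- The origin of 40: a tie has probability at least 1/(2H) with H = 2h, and L = 20 H makes 10e
    -- equal to exactly this.
    10e≤ℙ : e * ι 10 ≤ ℙ[count≡ k ] d
    10e≤ℙ = begin
      e * ι 10                                      ≡⟨ *-identityʳ _ ⟨
      e * ι 10 * 1ℚ                                 ≤⟨ *-monoˡ (e * ι 10) (0≤* 0≤e (0≤ι 10)) 1≤2Hℙ ⟩
      e * ι 10 * (ι (2 ℕ.* H) * ℙ[count≡ k ] d)     ≡⟨ cong (λ z → e * ι 10 * (z * ℙ[count≡ k ] d)) (ι-* 2 H) ⟩
      e * ι 10 * (2ℚ * ι H * ℙ[count≡ k ] d)        ≡⟨ identity e (ι H) (ℙ[count≡ k ] d) ⟩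
      e * (ι 20 * ι H) * ℙ[count≡ k ] d             ≡⟨ cong (λ z → e * z * ℙ[count≡ k ] d) (trans (cong ι L≡40h) (ι-* 20 H)) ⟨
      e * ι L * ℙ[count≡ k ] d                      ≡⟨ cong (_* ℙ[count≡ k ] d) eL≡1 ⟩
      1ℚ * ℙ[count≡ k ] d                           ≡⟨ *-identityˡ _ ⟩
      ℙ[count≡ k ] d                                ∎
      where
      identity : ∀ e x p → e * ι 10 * (2ℚ * x * p) ≡ e * (ι 20 * x) * p
      identity = solve-∀ ℚ-ring
      open ≤-Reasoning


    a*4L≡ : ∀ a → a ℕ.* q ℕ.+ a ≡ 4 ℕ.* L ℕ.* a
    a*4L≡ a = trans (trans (ℕP.+-comm (a ℕ.* q) a) (cong (a ℕ.+_) (ℕP.*-comm a q))) (cong (ℕ._* a) 1+q≡4L)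
    n-lower : ∀ n → 4 ℕ.* L ℕ.* (n ℕ./ q) ℕ.≤ n ℕ.+ (n ℕ./ q)
    n-lower n = subst (ℕ._≤ n ℕ.+ (n ℕ./ q)) (a*4L≡ (n ℕ./ q)) (ℕP.+-monoˡ-≤ (n ℕ./ q) (DivMod.m/n*n≤m n q))

    n-upper : ∀ n → n ℕ.+ suc (n ℕ./ q) ℕ.≤ 4 ℕ.* L ℕ.* suc (n ℕ./ q)
    n-upper n = subst (n ℕ.+ suc (n ℕ./ q) ℕ.≤_) (a*4L≡ (suc (n ℕ./ q)))
                (ℕP.+-monoˡ-≤ (suc (n ℕ./ q)) (subst (ℕ._≤ suc (n ℕ./ q) ℕ.* q) (sym (DivMod.m≡m%n+[m/n]*n n q))
                  (ℕP.+-monoˡ-≤ ((n ℕ./ q) ℕ.* q) (ℕP.<⇒≤ (DivMod.m%n<n n q)))))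
    a-large : ∀ n A → 4 ℕ.* L ℕ.* A ℕ.≤ n → A ℕ.≤ n ℕ./ q
    a-large n A N≤n = subst (ℕ._≤ n ℕ./ q) (DivMod.m*n/n≡m A q) (DivMod./-monoˡ-≤ q (ℕP.≤-trans (ℕP.*-monoʳ-≤ A (ℕP.n≤1+n q))
                (ℕP.≤-trans (ℕP.≤-reflexive (trans (ℕP.*-comm A (suc q)) (cong (ℕ._* A) 1+q≡4L))) N≤n)))

  rate-lower : ∀ n .{{_ : ℕ.NonZero n}} → 4 ℕ.* L ℕ.* (L ℕ.* (16 ℕ.* L ℕ.* suc d)) ℕ.≤ n → ½ + e * (+ 1 / 16) ≤ lcsRate 2 (suc d) n
  rate-lower n N≤n = *-cancelʳ-≤ (0<ι n) (begin
    (½ + e * (+ 1 / 16)) * ι n      ≡⟨ *-comm (½ + e * (+ 1 / 16)) (ι n) ⟩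
    ι n * (½ + e * (+ 1 / 16))      ≤⟨ 𝔼LCS-lower d k n (n ℕ./ q) 10e≤ℙ (n-lower n) (n-upper n) (a-large n _ N≤n) ⟩
    𝔼LCS (suc d) n                  ≡⟨ lcsRate*n (suc d) n ⟨
    lcsRate 2 (suc d) n * ι n       ∎)
    where open ≤-Reasoning

  halfPlusLeGamma : HalfPlusLeGamma 2 (suc d) c₁
  -- The `suc` only forces n > 0, where the rate is a genuine quotient; ε is spent as slack.
  halfPlusLeGamma ε 0<ε = suc (4 ℕ.* L ℕ.* (L ℕ.* (16 ℕ.* L ℕ.* suc d))) , λ n N<n → gtHalfPlus (suc d) h 0<v
    (≤-trans (rate-lower n {{ℕ.>-nonZero (ℕP.≤-trans (s≤s z≤n) N<n)}} (ℕP.<⇒≤ N<n)) (≤-by ε (<⇒≤ 0<ε) refl)) v*h h²≤d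
    where
    0<v : 0ℚ < e * (+ 1 / 16)
    0<v = subst (_< e * (+ 1 / 16)) (*-zeroʳ e) (*-monoʳ-<-pos e {{positive 0<e}} (0<1/ 16))
    identity : ∀ e h → e * (+ 1 / 16) * h ≡ (+ 1 / 640) * (e * (ι 20 * (ι 2 * h)))
    identity = solve-∀ ℚ-ring
    v*h : e * (+ 1 / 16) * ι h ≡ + 1 / 640
    v*h = trans (identity e (ι h)) (trans (cong (λ z → (+ 1 / 640) * (e * z)) (sym (trans (cong ι L≡40h) (trans (ι-* 20 H) (cong (ι 20 *_) (ι-* 2 h))))))
                (trans (cong ((+ 1 / 640) *_) eL≡1) (*-identityʳ (+ 1 / 640))))

halfPlusLeGamma : ∀ d → HalfPlusLeGamma 2 (suc d) c₁
halfPlusLeGamma d = scale (sqrt-bounds d)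
  where
  scaled : ∀ h L .{{_ : ℕ.NonZero h}} .{{_ : ℕ.NonZero L}} → L ≡ 20 ℕ.* (2 ℕ.* h) →
           h ℕ.* h ℕ.≤ suc d → suc d ℕ.≤ 4 ℕ.* (h ℕ.* h) → HalfPlusLeGamma 2 (suc d) c₁
  scaled h L L≡40h h²≤d d≤4h² = Lower.halfPlusLeGamma d h L q (+ 1 / L) h²≤d d≤4h² L≡40h
    (cong (ℕ._+ 3 ℕ.* L) (ℕP.suc-pred L)) (0<1/ L) (/-*-ι 1 L)
    where
    -- This is 4L - 1, arranged so that `suc q` is 4L by `suc-pred`.
    q = ℕ.pred L ℕ.+ 3 ℕ.* L
    instance
      q≢0 : ℕ.NonZero q
      q≢0 = ℕ.>-nonZero (ℕP.<-≤-trans (ℕ.>-nonZero⁻¹ (3 ℕ.* L) {{ℕP.m*n≢0 3 L}}) (ℕP.m≤n+m (3 ℕ.* L) (ℕ.pred L)))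
  scale : ∃[ h ] (suc h ℕ.* suc h ℕ.≤ suc d × suc d ℕ.≤ 4 ℕ.* (suc h ℕ.* suc h)) → HalfPlusLeGamma 2 (suc d) c₁
  scale (h-1 , h²≤d , d≤4h²) = scaled (suc h-1) (20 ℕ.* (2 ℕ.* suc h-1)) refl h²≤d d≤4h²

-- Upper bound

𝟙-mono : ∀ {P Q : Set} (P? : Dec P) (Q? : Dec Q) → (P → Q) → 𝟙 (does P?) ≤ 𝟙 (does Q?)
𝟙-mono (yes p) (yes q) P⇒Q = ≤-refl
𝟙-mono (yes p) (no ¬q) P⇒Q = ⊥-elim (¬q (P⇒Q p))
𝟙-mono (no ¬p) (yes q) P⇒Q = 0≤1
𝟙-mono (no ¬p) (no ¬q) P⇒Q = ≤-refl

0≤𝟙 : ∀ b → 0ℚ ≤ 𝟙 b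
0≤𝟙 true  = 0≤1
0≤𝟙 false = ≤-refl

𝟙≤1 : ∀ b → 𝟙 b ≤ 1ℚ
𝟙≤1 true  = ≤-refl
𝟙≤1 false = 0≤1

ℙ[_⊆] : Str → ℕ → ℚ
ℙ[ w ⊆] n = 𝔼 (word n) (λ X → 𝟙 (does (w ⊆? X)))

module _ (α r : ℚ) (1≤α : 1ℚ ≤ α) (0≤r : 0ℚ ≤ r) (half : ½ * (1ℚ + r) ≤ α * r) where

  -- Conditioning on the first letter of the string: with probability 1/2 it matches the head of `w`
  -- and one letter of `w` is done, otherwise `w` stays. The recursion sees only the length of `w`,
  -- so one bound serves the whole union bound.
  ℙ-⊆-bound : ∀ n w → ℙ[ w ⊆] n ≤ α ^ n * r ^ length w
  ℙ-⊆-bound n [] = begin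
    ℙ[ [] ⊆] n                ≤⟨ 𝔼-mono (word n) (λ X → 𝟙≤1 (does ([] ⊆? X))) ⟩
    𝔼 (word n) (λ _ → 1ℚ)     ≡⟨ 𝔼-const (word n) 1ℚ ⟩
    1ℚ                        ≤⟨ 1≤^ n 1≤α ⟩
    α ^ n                     ≡⟨ *-identityʳ (α ^ n) ⟨
    α ^ n * 1ℚ                ∎
    where open ≤-Reasoning
  ℙ-⊆-bound zero (a ∷ w) = 0≤* 0≤1 (0≤^ (suc (length w)) 0≤r)
  ℙ-⊆-bound (suc n) (a ∷ w) = begin
    ℙ[ a ∷ w ⊆] (suc n)                                                  ≡⟨ word-head n (λ X → 𝟙 (does (a ∷ w ⊆? X))) ⟩
    𝔼 coin (λ c → 𝔼 (word n) (λ X → 𝟙 (does (a ∷ w ⊆? c ∷ X))))          ≤⟨ first-letter a ⟩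
    ½ * (ℙ[ w ⊆] n + ℙ[ a ∷ w ⊆] n)                                      ≤⟨ average (ℙ-⊆-bound n w) (ℙ-⊆-bound n (a ∷ w)) ⟩
    ½ * (α ^ n * r ^ length w + α ^ n * (r * r ^ length w))              ≡⟨ factor (α ^ n) (r ^ length w) r ⟩
    ½ * (1ℚ + r) * (α ^ n * r ^ length w)                                ≤⟨ *-monoʳ _ (0≤* (0≤^ n (≤-trans 0≤1 1≤α)) (0≤^ (length w) 0≤r)) half ⟩
    α * r * (α ^ n * r ^ length w)                                       ≡⟨ regroup α r (α ^ n) (r ^ length w) ⟩
    α ^ suc n * r ^ length (a ∷ w)                                       ∎
    where
    open ≤-Reasoning
    factor : ∀ x y r → ½ * (x * y + x * (r * y)) ≡ ½ * (1ℚ + r) * (x * y)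
    factor = solve-∀ ℚ-ring
    regroup : ∀ α r x y → α * r * (x * y) ≡ α * x * (r * y)
    regroup = solve-∀ ℚ-ring
    match : ∀ a → 𝔼 (word n) (λ X → 𝟙 (does (a ∷ w ⊆? a ∷ X))) ≤ ℙ[ w ⊆] n
    match a = 𝔼-mono (word n) (λ X → 𝟙-mono (a ∷ w ⊆? a ∷ X) (w ⊆? X) ∷⁻)
    mismatch : ∀ a c → ¬ a ≡ c → 𝔼 (word n) (λ X → 𝟙 (does (a ∷ w ⊆? c ∷ X))) ≤ ℙ[ a ∷ w ⊆] n
    mismatch a c a≢c = 𝔼-mono (word n) (λ X → 𝟙-mono (a ∷ w ⊆? c ∷ X) (a ∷ w ⊆? X) (∷ʳ⁻ a≢c))
    first-letter : ∀ a → 𝔼 coin (λ c → 𝔼 (word n) (λ X → 𝟙 (does (a ∷ w ⊆? c ∷ X)))) ≤ ½ * (ℙ[ w ⊆] n + ℙ[ a ∷ w ⊆] n)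
    first-letter 0b = average (match 0b) (mismatch 0b 1b λ ())
    first-letter 1b = ≤-trans (average (mismatch 1b 0b λ ()) (match 1b)) (≤-reflexive (cong (½ *_) (+-comm (ℙ[ 1b ∷ w ⊆] n) (ℙ[ w ⊆] n))))

ℙ-common : ∀ d n w → 𝔼 (uniform d n) (λ Xs → 𝟙 (does (common? w (Vec.toList Xs)))) ≡ ℙ[ w ⊆] n ^ d
ℙ-common zero    n w = refl
ℙ-common (suc d) n w = begin
  𝔼 U (λ t → 𝔼 (word n) (λ X → 𝟙 (does (common? w (X ∷ Vec.toList t)))))
    ≡⟨ 𝔼-cong U (λ t → trans (𝔼-cong (word n) (λ X → factor X (Vec.toList t)))
                             (𝔼-*ʳ (word n) (λ X → 𝟙 (does (w ⊆? X))) (𝟙 (does (common? w (Vec.toList t)))))) ⟩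
  𝔼 U (λ t → ℙ[ w ⊆] n * 𝟙 (does (common? w (Vec.toList t))))
    ≡⟨ 𝔼-* U (ℙ[ w ⊆] n) (λ t → 𝟙 (does (common? w (Vec.toList t)))) ⟩
  ℙ[ w ⊆] n * 𝔼 U (λ t → 𝟙 (does (common? w (Vec.toList t))))
    ≡⟨ cong (ℙ[ w ⊆] n *_) (ℙ-common d n w) ⟩
  ℙ[ w ⊆] n ^ suc d
    ∎
  where
  open ≡-Reasoning
  U = uniform d n
  factor : ∀ X Xs → 𝟙 (does (common? w (X ∷ Xs))) ≡ 𝟙 (does (w ⊆? X)) * 𝟙 (does (common? w Xs))
  factor X Xs with does (w ⊆? X)
  ... | true  = sym (*-identityˡ _)
  ... | false = sym (*-zeroˡ (𝟙 (does (common? w Xs))))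

Σₗ : (Str → ℚ) → List Str → ℚ
Σₗ f []       = 0ℚ
Σₗ f (w ∷ ws) = f w + Σₗ f ws

𝔼-Σₗ : ∀ {A} (m : Mean A) (f : A → Str → ℚ) ws → 𝔼 m (λ a → Σₗ (f a) ws) ≡ Σₗ (λ w → 𝔼 m (λ a → f a w)) ws
𝔼-Σₗ m f []       = 𝔼-const m 0ℚ
𝔼-Σₗ m f (w ∷ ws) = trans (𝔼-+ m (λ a → f a w) (λ a → Σₗ (f a) ws)) (cong (_+_ (𝔼 m (λ a → f a w))) (𝔼-Σₗ m f ws))

Σₗ-bound : ∀ {f B ws} → All (λ w → f w ≤ B) ws → Σₗ f ws ≤ ι (length ws) * B
Σₗ-bound {B = B} []       = ≤-reflexive (sym (*-zeroˡ B))
Σₗ-bound {f} {B} {w ∷ ws} (p ∷ ps) = begin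
  f w + Σₗ f ws              ≤⟨ +-mono-≤ p (Σₗ-bound ps) ⟩
  B + ι (length ws) * B      ≡⟨ identity B (ι (length ws)) ⟩
  (1ℚ + ι (length ws)) * B   ≡⟨ cong (_* B) (ι-+ 1 (length ws)) ⟨
  ι (suc (length ws)) * B    ∎
  where
  open ≤-Reasoning
  identity : ∀ x y → x + y * x ≡ (1ℚ + y) * x
  identity = solve-∀ ℚ-ring

-- The excess of a maximum over `l` is at most the sum of all excesses. In this form the union bound
-- acts on the expectation directly, and words of length at most `l` contribute nothing.
longest-≤ : ∀ l Xs ws → ι (longest Xs ws) ≤ ι l + Σₗ (λ w → ι (length w ℕ.∸ l) * 𝟙 (does (common? w Xs))) ws
longest-≤ l Xs []       = ≤-trans (0≤ι l) (≤-reflexive (sym (+-identityʳ (ι l))))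
longest-≤ l Xs (w ∷ ws) with does (common? w Xs)
... | false = ≤-trans (longest-≤ l Xs ws) (≤-reflexive (identity (ι l) (ι (length w ℕ.∸ l)) _))
  where
  identity : ∀ x y z → x + z ≡ x + (y * 0ℚ + z)
  identity = solve-∀ ℚ-ring
... | true with ℕP.⊔-sel (length w) (longest Xs ws)
...   | inj₁ eq = begin
  ι (length w ℕ.⊔ longest Xs ws)                  ≡⟨ cong ι eq ⟩
  ι (length w)                                    ≤⟨ ι-mono-≤ (ℕP.m≤n+m∸n (length w) l) ⟩
  ι (l ℕ.+ (length w ℕ.∸ l))                      ≡⟨ ι-+ l (length w ℕ.∸ l) ⟩
  ι l + x                                         ≤⟨ ≤-by S (0≤S ws) (identity (ι l) x S) ⟩
  ι l + (x * 1ℚ + S)                              ∎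
  where
  open ≤-Reasoning
  x = ι (length w ℕ.∸ l)
  S = Σₗ (λ w → ι (length w ℕ.∸ l) * 𝟙 (does (common? w Xs))) ws
  identity : ∀ a x s → a + x + s ≡ a + (x * 1ℚ + s)
  identity = solve-∀ ℚ-ring
  0≤S : ∀ ws → 0ℚ ≤ Σₗ (λ w → ι (length w ℕ.∸ l) * 𝟙 (does (common? w Xs))) ws
  0≤S []       = ≤-refl
  0≤S (w ∷ ws) = 0≤+ (0≤* (0≤ι (length w ℕ.∸ l)) (0≤𝟙 (does (common? w Xs)))) (0≤S ws)
...   | inj₂ eq = begin
  ι (length w ℕ.⊔ longest Xs ws)                  ≡⟨ cong ι eq ⟩
  ι (longest Xs ws)                               ≤⟨ longest-≤ l Xs ws ⟩
  ι l + S                                         ≤⟨ ≤-by x (0≤ι (length w ℕ.∸ l)) (identity (ι l) x S) ⟩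
  ι l + (x * 1ℚ + S)                              ∎
  where
  open ≤-Reasoning
  x = ι (length w ℕ.∸ l)
  S = Σₗ (λ w → ι (length w ℕ.∸ l) * 𝟙 (does (common? w Xs))) ws
  identity : ∀ a x s → a + s + x ≡ a + (x * 1ℚ + s)
  identity = solve-∀ ℚ-ring

strings-length : ∀ n → All (λ w → length w ≡ n) (strings 2 n)
strings-length zero    = refl ∷ []
strings-length (suc n) = AllP.concat⁺ (AllP.map⁺ (All.map (λ eq → cong suc eq ∷ cong suc eq ∷ []) (strings-length n)))

stringsUpTo-length : ∀ n → All (λ w → length w ℕ.≤ n) (stringsUpTo 2 n)
stringsUpTo-length zero    = z≤n ∷ []
stringsUpTo-length (suc n) = AllP.++⁺ (All.map ℕP.≤-reflexive (strings-length (suc n)))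
                                      (All.map ℕP.m≤n⇒m≤1+n (stringsUpTo-length n))

length-strings : ∀ n → length (strings 2 n) ≡ 2 ℕ.^ n
length-strings zero    = refl
length-strings (suc n) = trans (double (strings 2 n)) (cong (2 ℕ.*_) (length-strings n))
  where
  double : ∀ (ws : List Str) → length (concatMap (λ w → List.map (_∷ w) (allFin 2)) ws) ≡ 2 ℕ.* length ws
  double []       = refl
  double (w ∷ ws) = trans (cong (2 ℕ.+_) (double ws)) (sym (ℕP.*-suc 2 (length ws)))

length-stringsUpTo : ∀ n → length (stringsUpTo 2 n) ℕ.≤ 2 ℕ.^ suc n
length-stringsUpTo zero    = s≤s z≤n
length-stringsUpTo (suc n) = begin
  length (strings 2 (suc n) List.++ stringsUpTo 2 n)           ≡⟨ ListP.length-++ (strings 2 (suc n)) ⟩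
  length (strings 2 (suc n)) ℕ.+ length (stringsUpTo 2 n)      ≤⟨ ℕP.+-mono-≤ (ℕP.≤-reflexive (length-strings (suc n))) (length-stringsUpTo n) ⟩
  2 ℕ.^ suc n ℕ.+ 2 ℕ.^ suc n                                  ≡⟨ cong (2 ℕ.^ suc n ℕ.+_) (ℕP.+-identityʳ _) ⟨
  2 ℕ.^ suc (suc n)                                            ∎
  where open ℕP.≤-Reasoning

module _ (α r : ℚ) (1≤α : 1ℚ ≤ α) (0≤r : 0ℚ ≤ r) (r≤1 : r ≤ 1ℚ) (half : ½ * (1ℚ + r) ≤ α * r) where

  𝔼LCS-upper : ∀ d n l → 𝔼LCS d n ≤ ι l + ι (2 ℕ.^ suc n) * (ι n * (α ^ n * r ^ l) ^ d)
  𝔼LCS-upper d n l = begin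
    𝔼LCS d n
      ≤⟨ 𝔼-mono U (λ Xs → ≤-trans (≤-reflexive (cong ι (LCS≡longest n (Vec.toList Xs)))) (longest-≤ l (Vec.toList Xs) W)) ⟩
    𝔼 U (λ Xs → ι l + Σₗ (λ w → f w Xs) W)
      ≡⟨ 𝔼-+ U (λ _ → ι l) (λ Xs → Σₗ (λ w → f w Xs) W) ⟩
    𝔼 U (λ _ → ι l) + 𝔼 U (λ Xs → Σₗ (λ w → f w Xs) W)
      ≡⟨ cong₂ _+_ (𝔼-const U (ι l)) (𝔼-Σₗ U (λ Xs w → f w Xs) W) ⟩
    ι l + Σₗ (λ w → 𝔼 U (f w)) W
      ≤⟨ +-monoʳ-≤ (ι l) (Σₗ-bound (All.map (λ {w} → each w) (stringsUpTo-length n))) ⟩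
    ι l + ι (length W) * B
      ≤⟨ +-monoʳ-≤ (ι l) (*-monoʳ B (0≤* (0≤ι n) 0≤γ^d) (ι-mono-≤ (length-stringsUpTo n))) ⟩
    ι l + ι (2 ℕ.^ suc n) * B
      ∎
    where
    open ≤-Reasoning
    U = uniform d n
    W = stringsUpTo 2 n
    γ = α ^ n * r ^ l
    B = ι n * γ ^ d
    0≤α^n = 0≤^ n (≤-trans 0≤1 1≤α)
    0≤γ^d = 0≤^ d (0≤* 0≤α^n (0≤^ l 0≤r))
    f : Str → Vec Str d → ℚ
    f w Xs = ι (length w ℕ.∸ l) * 𝟙 (does (common? w (Vec.toList Xs)))
    0≤ℙ : ∀ w → 0ℚ ≤ ℙ[ w ⊆] n
    0≤ℙ w = ≤-trans (≤-reflexive (sym (𝔼-const (word n) 0ℚ))) (𝔼-mono (word n) (λ X → 0≤𝟙 (does (w ⊆? X))))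
    each : ∀ w → length w ℕ.≤ n → 𝔼 U (f w) ≤ B
    each w ∣w∣≤n with ℕP.≤-total (length w) l
    ... | inj₁ ∣w∣≤l = begin
      𝔼 U (f w)                                               ≡⟨ 𝔼-cong U (λ Xs → trans (cong (λ z → ι z * 𝟙 (does (common? w (Vec.toList Xs)))) (ℕP.m≤n⇒m∸n≡0 ∣w∣≤l)) (*-zeroˡ (𝟙 (does (common? w (Vec.toList Xs)))))) ⟩
      𝔼 U (λ _ → 0ℚ)                                          ≡⟨ 𝔼-const U 0ℚ ⟩
      0ℚ                                                      ≤⟨ 0≤* (0≤ι n) 0≤γ^d ⟩
      B                                                       ∎
    ... | inj₂ l≤∣w∣ = begin
      𝔼 U (f w)                                               ≡⟨ 𝔼-* U (ι (length w ℕ.∸ l)) (λ Xs → 𝟙 (does (common? w (Vec.toList Xs)))) ⟩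
      ι (length w ℕ.∸ l) * 𝔼 U (λ Xs → 𝟙 (does (common? w (Vec.toList Xs))))
                                                              ≡⟨ cong (ι (length w ℕ.∸ l) *_) (ℙ-common d n w) ⟩
      ι (length w ℕ.∸ l) * ℙ[ w ⊆] n ^ d                      ≤⟨ *-mono (0≤ι (length w ℕ.∸ l)) 0≤γ^d
                                                                   (ι-mono-≤ (ℕP.≤-trans (ℕP.m∸n≤m (length w) l) ∣w∣≤n))
                                                                   (^-monoˡ-≤ d (0≤ℙ w) (≤-trans (ℙ-⊆-bound α r 1≤α 0≤r half n w)
                                                                     (*-monoˡ (α ^ n) 0≤α^n (^-antitoneʳ 0≤r r≤1 l≤∣w∣)))) ⟩
      B                                                       ∎

-- Choice of parameters for the upper bound

^-monoʳ-≤ : ∀ {p m n} → 1ℚ ≤ p → m ℕ.≤ n → p ^ m ≤ p ^ n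
^-monoʳ-≤ {p} {m} 1≤p m≤n with ℕP.m≤n⇒∃[o]m+o≡n m≤n
... | k , refl = begin
  p ^ m            ≡⟨ *-identityʳ _ ⟨
  p ^ m * 1ℚ       ≤⟨ *-monoˡ (p ^ m) (0≤^ m (≤-trans 0≤1 1≤p)) (1≤^ k 1≤p) ⟩
  p ^ m * p ^ k    ≡⟨ ^-homo-* p m k ⟨
  p ^ (m ℕ.+ k)    ∎
  where open ≤-Reasoning

^-comm : ∀ p m n → (p ^ m) ^ n ≡ (p ^ n) ^ m
^-comm p m n = trans (^-assocʳ p m n) (trans (cong (p ^_) (ℕP.*-comm m n)) (sym (^-assocʳ p n m)))

-- α is a polynomial upper bound for (1 + r)/(2r).
module Upper (d h : ℕ) (e : ℚ) .{{_ : ℕ.NonZero h}} (h²≤d : h ℕ.* h ℕ.≤ d) (d≤4h² : d ℕ.≤ 4 ℕ.* (h ℕ.* h))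
             (0≤e : 0ℚ ≤ e) (e2h≡1 : e * ι (2 ℕ.* h) ≡ 1ℚ) where

  r α Y : ℚ
  r = 1ℚ - e
  α = 1ℚ + (½ * e + e * e)
  Y = 1ℚ + 2ℚ * (e * e)

  private
    0≤e² : 0ℚ ≤ e * e
    0≤e² = 0≤* 0≤e 0≤e

    e*2≤1 : e * 2ℚ ≤ 1ℚ
    e*2≤1 = subst (e * 2ℚ ≤_) e2h≡1 (*-monoˡ e 0≤e (ι-mono-≤ (ℕP.m≤m*n 2 h)))

    e≤1 : e ≤ 1ℚ
    e≤1 = ≤-trans (≤-by e 0≤e (double e)) e*2≤1
      where
      double : ∀ e → e + e ≡ e * 2ℚ
      double = solve-∀ ℚ-ring

    0≤r : 0ℚ ≤ r
    0≤r = ≤⇒0≤- e≤1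

    r≤1 : r ≤ 1ℚ
    r≤1 = ≤-by e 0≤e (identity e)
      where
      identity : ∀ e → 1ℚ - e + e ≡ 1ℚ
      identity = solve-∀ ℚ-ring

    1≤α : 1ℚ ≤ α
    1≤α = ≤-by (½ * e + e * e) (0≤+ (0≤* (0≤-literal 1 2) 0≤e) 0≤e²) refl

    0≤2e² : 0ℚ ≤ 2ℚ * (e * e)
    0≤2e² = 0≤* (0≤-literal 2 1) 0≤e²

    1≤Y : 1ℚ ≤ Y
    1≤Y = ≤-by (2ℚ * (e * e)) 0≤2e² refl

    half : ½ * (1ℚ + r) ≤ α * r
    half = ≤-by (½ * (e * e) * (1ℚ - e * 2ℚ)) (0≤* (0≤* (0≤-literal 1 2) 0≤e²) (≤⇒0≤- e*2≤1)) (identity e)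
      where
      identity : ∀ e → ½ * (1ℚ + (1ℚ - e)) + ½ * (e * e) * (1ℚ - e * 2ℚ) ≡ (1ℚ + (½ * e + e * e)) * (1ℚ - e)
      identity = solve-∀ ℚ-ring

    -- The e/2 in `α` is doubled by squaring and cancels against `r`, so only order e² remains. This
    -- cancellation is what places the threshold at half of n.
    α²r≤Y : α * α * r ≤ Y
    α²r≤Y = ≤-by (+ 3 / 4 * (e * e) + + 5 / 4 * (e * (e * e)) + e * (e * e) * (e * e))
      (0≤+ (0≤+ (0≤* (0≤-literal 3 4) 0≤e²) (0≤* (0≤-literal 5 4) (0≤* 0≤e 0≤e²))) (0≤* (0≤* 0≤e 0≤e²) 0≤e²))
      (identity e)
      where
      identity : ∀ e → (1ℚ + (½ * e + e * e)) * (1ℚ + (½ * e + e * e)) * (1ℚ - e)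
                         + (+ 3 / 4 * (e * e) + + 5 / 4 * (e * (e * e)) + e * (e * e) * (e * e))
                       ≡ 1ℚ + 2ℚ * (e * e)
      identity = solve-∀ ℚ-ring

    2h²e²≡½ : ι (h ℕ.* h) * (2ℚ * (e * e)) ≡ ½
    2h²e²≡½ = trans (cong (_* (2ℚ * (e * e))) (ι-* h h)) (trans (identity (ι h) e)
               (cong (λ z → ½ * (z * z)) (trans (cong (e *_) (sym (ι-* 2 h))) e2h≡1)))
      where
      identity : ∀ h e → h * h * (2ℚ * (e * e)) ≡ ½ * (e * (2ℚ * h) * (e * (2ℚ * h)))
      identity = solve-∀ ℚ-ring

    -- With y = 2e² and N = h² one has N y = 1/2, so Bernoulli gives (1 - y)^N ≥ 1/2; the product
    -- with (1 + y)^N is at most 1.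
    Y^h²≤2 : Y ^ (h ℕ.* h) ≤ 2ℚ
    Y^h²≤2 = begin
      Y ^ N                                           ≡⟨ identity (Y ^ N) ⟩
      2ℚ * ((1ℚ - ½) * Y ^ N)                         ≡⟨ cong (λ z → 2ℚ * ((1ℚ - z) * Y ^ N)) 2h²e²≡½ ⟨
      2ℚ * ((1ℚ - ι N * (2ℚ * (e * e))) * Y ^ N)      ≤⟨ *-monoˡ 2ℚ (0≤-literal 2 1) (*-monoʳ (Y ^ N) (0≤^ N (≤-trans 0≤1 1≤Y)) (bernoulli⁻ N 0≤2e² 2e²≤1)) ⟩
      2ℚ * ((1ℚ - 2ℚ * (e * e)) ^ N * Y ^ N)          ≤⟨ *-monoˡ 2ℚ (0≤-literal 2 1) ([1-y]^n*[1+y]^n≤1 N 0≤2e² 2e²≤1) ⟩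
      2ℚ * 1ℚ                                         ≡⟨⟩
      2ℚ                                              ∎
      where
      open ≤-Reasoning
      N = h ℕ.* h
      identity : ∀ y → y ≡ 2ℚ * ((1ℚ - ½) * y)
      identity = solve-∀ ℚ-ring
      identity′ : ∀ e → e * 2ℚ * e ≡ 2ℚ * (e * e)
      identity′ = solve-∀ ℚ-ring
      2e²≤1 : 2ℚ * (e * e) ≤ 1ℚ
      2e²≤1 = subst (_≤ 1ℚ) (identity′ e) (*-mono {e * 2ℚ} {1ℚ} {e} {1ℚ} (0≤* 0≤e (0≤-literal 2 1)) 0≤1 e*2≤1 e≤1)

    Y^d≤16 : Y ^ d ≤ ι 16
    Y^d≤16 = begin
      Y ^ d                       ≤⟨ ^-monoʳ-≤ 1≤Y d≤4h² ⟩
      Y ^ (4 ℕ.* (h ℕ.* h))       ≡⟨ cong (Y ^_) (ℕP.*-comm 4 (h ℕ.* h)) ⟩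
      Y ^ (h ℕ.* h ℕ.* 4)         ≡⟨ ^-assocʳ Y (h ℕ.* h) 4 ⟨
      (Y ^ (h ℕ.* h)) ^ 4         ≤⟨ ^-monoˡ-≤ 4 (0≤^ (h ℕ.* h) (≤-trans 0≤1 1≤Y)) Y^h²≤2 ⟩
      2ℚ ^ 4                      ≡⟨⟩
      ι 16                        ∎
      where open ≤-Reasoning

    r^2h≤½ : r ^ (2 ℕ.* h) ≤ ½
    r^2h≤½ = begin
      r ^ (2 ℕ.* h)                                     ≡⟨ identity (r ^ (2 ℕ.* h)) ⟩
      ½ * (r ^ (2 ℕ.* h) * (1ℚ + 1ℚ))                   ≡⟨ cong (λ z → ½ * (r ^ (2 ℕ.* h) * (1ℚ + z))) (trans (*-comm (ι (2 ℕ.* h)) e) e2h≡1) ⟨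
      ½ * (r ^ (2 ℕ.* h) * (1ℚ + ι (2 ℕ.* h) * e))      ≤⟨ *-monoˡ ½ (0≤-literal 1 2) (inverse-bernoulli (2 ℕ.* h) 0≤e e≤1) ⟩
      ½ * 1ℚ                                            ≡⟨⟩
      ½                                                 ∎
      where
      open ≤-Reasoning
      identity : ∀ x → x ≡ ½ * (x * (1ℚ + 1ℚ))
      identity = solve-∀ ℚ-ring

    ¼ : ℚ
    ¼ = + 1 / 4

  -- Squaring replaces l by 2l ≥ n + t and so avoids halving n. Then `Y` contributes at most 16^n,
  -- and the t extra letters contribute r^(t d) ≤ 2^(-8n) because t d ≥ 16 n h; the product is
  -- 16^(-n), the square of 4^(-n).
  γ^d≤¼^n : ∀ n l t → n ℕ.+ t ℕ.≤ 2 ℕ.* l → 16 ℕ.* n ℕ.≤ h ℕ.* t → (α ^ n * r ^ l) ^ d ≤ ¼ ^ n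
  γ^d≤¼^n n l t n+t≤2l 16n≤ht = ²-cancel-≤ (0≤^ n (0≤-literal 1 4)) (begin
    γ ^ d * γ ^ d                            ≡⟨ ^-distrib-* γ γ d ⟨
    (γ * γ) ^ d                              ≤⟨ ^-monoˡ-≤ d (0≤* 0≤γ 0≤γ) γ²≤ ⟩
    (Y ^ n * r ^ t) ^ d                      ≡⟨ ^-distrib-* (Y ^ n) (r ^ t) d ⟩
    (Y ^ n) ^ d * (r ^ t) ^ d                ≤⟨ *-mono (0≤^ d (0≤^ n 0≤Y)) (0≤^ n (0≤^ 8 (0≤-literal 1 2))) Y-part r-part ⟩
    ι 16 ^ n * (½ ^ 8) ^ n                   ≡⟨ ^-distrib-* (ι 16) (½ ^ 8) n ⟨
    (¼ * ¼) ^ n                              ≡⟨ ^-distrib-* ¼ ¼ n ⟩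
    ¼ ^ n * ¼ ^ n                            ∎)
    where
    open ≤-Reasoning
    γ = α ^ n * r ^ l
    0≤Y = ≤-trans 0≤1 1≤Y
    0≤α = ≤-trans 0≤1 1≤α
    0≤γ : 0ℚ ≤ γ
    0≤γ = 0≤* (0≤^ n 0≤α) (0≤^ l 0≤r)
    regroup : ∀ x y → x * y * (x * y) ≡ x * x * (y * y)
    regroup = solve-∀ ℚ-ring
    γ²≤ : γ * γ ≤ Y ^ n * r ^ t
    γ²≤ = begin
      γ * γ                                  ≡⟨ regroup (α ^ n) (r ^ l) ⟩
      α ^ n * α ^ n * (r ^ l * r ^ l)        ≡⟨ cong₂ _*_ (^-distrib-* α α n) (trans (cong (r ^_) (cong (l ℕ.+_) (ℕP.+-identityʳ l))) (^-homo-* r l l)) ⟨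
      (α * α) ^ n * r ^ (2 ℕ.* l)            ≤⟨ *-monoˡ ((α * α) ^ n) (0≤^ n (0≤* 0≤α 0≤α)) (^-antitoneʳ 0≤r r≤1 n+t≤2l) ⟩
      (α * α) ^ n * r ^ (n ℕ.+ t)            ≡⟨ trans (cong ((α * α) ^ n *_) (^-homo-* r n t)) (sym (*-assoc ((α * α) ^ n) (r ^ n) (r ^ t))) ⟩
      (α * α) ^ n * r ^ n * r ^ t            ≡⟨ cong (_* r ^ t) (^-distrib-* (α * α) r n) ⟨
      (α * α * r) ^ n * r ^ t                ≤⟨ *-monoʳ (r ^ t) (0≤^ t 0≤r) (^-monoˡ-≤ n (0≤* (0≤* 0≤α 0≤α) 0≤r) α²r≤Y) ⟩
      Y ^ n * r ^ t                          ∎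
    Y-part : (Y ^ n) ^ d ≤ ι 16 ^ n
    Y-part = ≤-trans (≤-reflexive (^-comm Y n d)) (^-monoˡ-≤ n (0≤^ d 0≤Y) Y^d≤16)
    exponent : 2 ℕ.* h ℕ.* (8 ℕ.* n) ℕ.≤ t ℕ.* d
    exponent = ℕP.≤-trans (ℕP.≤-reflexive (shape h n)) (ℕP.≤-trans (ℕP.*-monoʳ-≤ h 16n≤ht)
                 (ℕP.≤-trans (ℕP.≤-reflexive (shape′ h t)) (ℕP.*-monoʳ-≤ t h²≤d)))
      where
      shape : ∀ h n → 2 ℕ.* h ℕ.* (8 ℕ.* n) ≡ h ℕ.* (16 ℕ.* n)
      shape = ℕSolver.solve-∀
      shape′ : ∀ h t → h ℕ.* (h ℕ.* t) ≡ t ℕ.* (h ℕ.* h)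
      shape′ = ℕSolver.solve-∀
    r-part : (r ^ t) ^ d ≤ (½ ^ 8) ^ n
    r-part = begin
      (r ^ t) ^ d                            ≡⟨ ^-assocʳ r t d ⟩
      r ^ (t ℕ.* d)                          ≤⟨ ^-antitoneʳ 0≤r r≤1 exponent ⟩
      r ^ (2 ℕ.* h ℕ.* (8 ℕ.* n))            ≡⟨ ^-assocʳ r (2 ℕ.* h) (8 ℕ.* n) ⟨
      (r ^ (2 ℕ.* h)) ^ (8 ℕ.* n)            ≤⟨ ^-monoˡ-≤ (8 ℕ.* n) (0≤^ (2 ℕ.* h) 0≤r) r^2h≤½ ⟩
      ½ ^ (8 ℕ.* n)                          ≡⟨ ^-assocʳ ½ 8 n ⟨
      (½ ^ 8) ^ n                            ∎

  n≤2^n : ∀ n → ι n ≤ 2ℚ ^ n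
  n≤2^n n = ≤-trans (≤-by 1ℚ 0≤1 (identity (ι n))) (bernoulli⁺ n 0≤1)
    where
    identity : ∀ x → x + 1ℚ ≡ 1ℚ + x * 1ℚ
    identity = solve-∀ ℚ-ring

  -- The reason for the rate 1/4: there are at most 2^(n+1) words, each with excess at most n ≤ 2^n,
  -- so the whole sum is at most 2.
  𝔼LCS-≤ : ∀ n l t → n ℕ.+ t ℕ.≤ 2 ℕ.* l → 16 ℕ.* n ℕ.≤ h ℕ.* t → 𝔼LCS d n ≤ ι (l ℕ.+ 2)
  𝔼LCS-≤ n l t n+t≤2l 16n≤ht = begin
    𝔼LCS d n                                                   ≤⟨ 𝔼LCS-upper α r 1≤α 0≤r r≤1 half d n l ⟩
    ι l + ι (2 ℕ.^ suc n) * (ι n * (α ^ n * r ^ l) ^ d)        ≤⟨ +-monoʳ-≤ (ι l) (*-monoˡ (ι (2 ℕ.^ suc n)) (0≤ι (2 ℕ.^ suc n))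
                                                                   (*-mono (0≤ι n) (0≤^ n (0≤-literal 1 4)) (n≤2^n n) (γ^d≤¼^n n l t n+t≤2l 16n≤ht))) ⟩
    ι l + ι (2 ℕ.^ suc n) * (2ℚ ^ n * ¼ ^ n)                   ≡⟨ cong (λ z → ι l + z) cancel ⟩
    ι l + ι 2                                                  ≡⟨ ι-+ l 2 ⟨
    ι (l ℕ.+ 2)                                                ∎
    where
    open ≤-Reasoning
    cancel : ι (2 ℕ.^ suc n) * (2ℚ ^ n * ¼ ^ n) ≡ 2ℚ
    cancel = trans (cong₂ _*_ (ι-^ 2 (suc n)) (sym (^-distrib-* 2ℚ ¼ n)))
               (trans (*-assoc 2ℚ (2ℚ ^ n) (½ ^ n))
                 (cong (2ℚ *_) (trans (sym (^-distrib-* 2ℚ ½ n)) (1^n≡1 n))))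

  rate-upper : ∀ n .{{_ : ℕ.NonZero n}} → 11 ℕ.* h ℕ.≤ n → (lcsRate 2 d n - ½) * ι h ≤ ι 9
  rate-upper n 11h≤n = begin
    (x - ½) * ι h                          ≡⟨ identity x (ι h) ⟩
    ½ * (x * (2ℚ * ι h) - ι h)             ≤⟨ *-monoˡ ½ (0≤-literal 1 2) (+-monoˡ-≤ (- ι h) x*2h≤h+18) ⟩
    ½ * (ι h + ι 18 - ι h)                 ≡⟨ identity′ (ι h) ⟩
    ι 9                                    ∎
    where
    open ≤-Reasoning
    x = lcsRate 2 d n
    u = n ℕ./ h
    v = n ℕ./ 2
    -- Both quotients are rounded up, so that t ≥ 16n/h and 2l ≥ n + t hold exactly.
    t = 16 ℕ.* suc u
    l = suc v ℕ.+ 8 ℕ.* suc u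
    identity : ∀ x h → (x - ½) * h ≡ ½ * (x * (2ℚ * h) - h)
    identity = solve-∀ ℚ-ring
    identity′ : ∀ h → ½ * (h + ι 18 - h) ≡ ι 9
    identity′ = solve-∀ ℚ-ring
    quotient-< : ∀ q .{{_ : ℕ.NonZero q}} → n ℕ.≤ q ℕ.* suc (n ℕ./ q)
    quotient-< q = ℕP.≤-trans (ℕP.≤-reflexive (DivMod.m≡m%n+[m/n]*n n q))
      (ℕP.≤-trans (ℕP.+-monoˡ-≤ (n ℕ./ q ℕ.* q) (ℕP.<⇒≤ (DivMod.m%n<n n q))) (ℕP.≤-reflexive (ℕP.*-comm (suc (n ℕ./ q)) q)))
    n+t≤2l : n ℕ.+ t ℕ.≤ 2 ℕ.* l
    n+t≤2l = ℕP.≤-trans (ℕP.+-monoˡ-≤ t (quotient-< 2)) (ℕP.≤-reflexive (shape u v))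
      where
      shape : ∀ u v → 2 ℕ.* (1 ℕ.+ v) ℕ.+ 16 ℕ.* (1 ℕ.+ u) ≡ 2 ℕ.* ((1 ℕ.+ v) ℕ.+ 8 ℕ.* (1 ℕ.+ u))
      shape = ℕSolver.solve-∀
    16n≤ht : 16 ℕ.* n ℕ.≤ h ℕ.* t
    16n≤ht = ℕP.≤-trans (ℕP.*-monoʳ-≤ 16 (quotient-< h)) (ℕP.≤-reflexive (shape h (suc u)))
      where
      shape : ∀ h u → 16 ℕ.* (h ℕ.* u) ≡ h ℕ.* (16 ℕ.* u)
      shape = ℕSolver.solve-∀
    -- Here l + 2 = v + 8u + 11. The terms in v and u give at most h n + 16 n, and the rounding
    -- constant 11 costs 22 h ≤ 2 n once n ≥ 11 h; hence 18.
    size : (l ℕ.+ 2) ℕ.* (2 ℕ.* h) ℕ.≤ (h ℕ.+ 18) ℕ.* n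
    size = ℕP.≤-trans (ℕP.≤-reflexive (shape h u v))
      (ℕP.≤-trans (ℕP.+-mono-≤ (ℕP.+-mono-≤ (ℕP.*-monoʳ-≤ h (DivMod.m/n*n≤m n 2)) (ℕP.*-monoʳ-≤ 16 (DivMod.m/n*n≤m n h)))
                               (ℕP.*-monoʳ-≤ 2 11h≤n))
                  (ℕP.≤-reflexive (shape′ h n)))
      where
      shape : ∀ h u v → ((1 ℕ.+ v) ℕ.+ 8 ℕ.* (1 ℕ.+ u) ℕ.+ 2) ℕ.* (2 ℕ.* h) ≡ h ℕ.* (v ℕ.* 2) ℕ.+ 16 ℕ.* (u ℕ.* h) ℕ.+ 2 ℕ.* (11 ℕ.* h)
      shape = ℕSolver.solve-∀
      shape′ : ∀ h n → h ℕ.* n ℕ.+ 16 ℕ.* n ℕ.+ 2 ℕ.* n ≡ (h ℕ.+ 18) ℕ.* n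
      shape′ = ℕSolver.solve-∀
    swap : ∀ x y z → x * y * z ≡ x * z * y
    swap = solve-∀ ℚ-ring
    x*2h≤h+18 : x * (2ℚ * ι h) ≤ ι h + ι 18
    x*2h≤h+18 = *-cancelʳ-≤ (0<ι n) (begin
      x * (2ℚ * ι h) * ι n           ≡⟨ trans (swap x (2ℚ * ι h) (ι n)) (cong₂ _*_ (lcsRate*n d n) (sym (ι-* 2 h))) ⟩
      𝔼LCS d n * ι (2 ℕ.* h)         ≤⟨ *-monoʳ (ι (2 ℕ.* h)) (0≤ι (2 ℕ.* h)) (𝔼LCS-≤ n l t n+t≤2l 16n≤ht) ⟩
      ι (l ℕ.+ 2) * ι (2 ℕ.* h)      ≡⟨ ι-* (l ℕ.+ 2) (2 ℕ.* h) ⟨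
      ι ((l ℕ.+ 2) ℕ.* (2 ℕ.* h))    ≤⟨ ι-mono-≤ size ⟩
      ι ((h ℕ.+ 18) ℕ.* n)           ≡⟨ trans (ι-* (h ℕ.+ 18) n) (cong (_* ι n) (ι-+ h 18)) ⟩
      (ι h + ι 18) * ι n             ∎)

-- Any value above 18 would serve: (x - 1/2) h ≤ 9 and √d ≤ 2h give (x - 1/2) √d ≤ 18, and the
-- comparison has to be strict.
c₂ : ℚ
c₂ = + 19 / 1

ltHalfPlus : ∀ {x y} d h → x ≤ y → (y - ½) * ι h ≤ ι 9 → d ℕ.≤ 4 ℕ.* (h ℕ.* h) → LtHalfPlus x c₂ d
ltHalfPlus {x} {y} d h x≤y yh≤9 d≤4h² with ≤-total x ½
... | inj₁ x≤½ = inj₁ x≤½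
... | inj₂ ½≤x = inj₂ (begin-strict
  (x - ½) * (x - ½) * (+ d / 1)                    ≡⟨ cong ((x - ½) * (x - ½) *_) (/1≡ι d) ⟩
  (x - ½) * (x - ½) * ι d                          ≤⟨ *-monoˡ ((x - ½) * (x - ½)) (0≤* 0≤x-½ 0≤x-½) (ι-mono-≤ d≤4h²) ⟩
  (x - ½) * (x - ½) * ι (4 ℕ.* (h ℕ.* h))          ≡⟨ cong ((x - ½) * (x - ½) *_) (trans (ι-* 4 (h ℕ.* h)) (cong (4ℚ *_) (ι-* h h))) ⟩
  (x - ½) * (x - ½) * (4ℚ * (ι h * ι h))           ≡⟨ identity (x - ½) (ι h) ⟩
  4ℚ * ((x - ½) * ι h * ((x - ½) * ι h))           ≤⟨ *-monoˡ 4ℚ (0≤-literal 4 1) (*-mono (0≤* 0≤x-½ (0≤ι h)) (0≤ι 9) xh≤9 xh≤9) ⟩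
  4ℚ * (ι 9 * ι 9)                                 <⟨ toWitness {a? = 4ℚ * (ι 9 * ι 9) <? c₂ * c₂} _ ⟩
  c₂ * c₂                                          ∎)
  where
  open ≤-Reasoning
  0≤x-½ = ≤⇒0≤- ½≤x
  xh≤9 : (x - ½) * ι h ≤ ι 9
  xh≤9 = ≤-trans (*-monoʳ (ι h) (0≤ι h) (+-monoˡ-≤ (- ½) x≤y)) yh≤9
  identity : ∀ y h → y * y * (4ℚ * (h * h)) ≡ 4ℚ * (y * h * (y * h))
  identity = solve-∀ ℚ-ring

gammaLeHalfPlus : ∀ d → GammaLeHalfPlus 2 (suc d) c₂
gammaLeHalfPlus d ε 0<ε = scale (sqrt-bounds d)
  where
  rate-ε≤rate : ∀ x → x - ε ≤ x
  rate-ε≤rate x = ≤-by ε (<⇒≤ 0<ε) (identity x ε)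
    where
    identity : ∀ x ε → x - ε + ε ≡ x
    identity = solve-∀ ℚ-ring
  scaled : ∀ h .{{_ : ℕ.NonZero h}} .{{_ : ℕ.NonZero (2 ℕ.* h)}} → h ℕ.* h ℕ.≤ suc d → suc d ℕ.≤ 4 ℕ.* (h ℕ.* h) →
           ∃[ N ] ∀ n → N ℕ.≤ n → LtHalfPlus (lcsRate 2 (suc d) n - ε) c₂ (suc d)
  scaled h h²≤d d≤4h² = suc (11 ℕ.* h) , λ n N<n → ltHalfPlus (suc d) h (rate-ε≤rate (lcsRate 2 (suc d) n))
    (Upper.rate-upper (suc d) h (+ 1 / (2 ℕ.* h)) h²≤d d≤4h² (<⇒≤ (0<1/ (2 ℕ.* h))) (/-*-ι 1 (2 ℕ.* h))
      n {{ℕ.>-nonZero (ℕP.≤-trans (s≤s z≤n) N<n)}} (ℕP.<⇒≤ N<n))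
    d≤4h²
  scale : ∃[ h ] (suc h ℕ.* suc h ℕ.≤ suc d × suc d ℕ.≤ 4 ℕ.* (suc h ℕ.* suc h)) →
          ∃[ N ] ∀ n → N ℕ.≤ n → LtHalfPlus (lcsRate 2 (suc d) n - ε) c₂ (suc d)
  scale (h-1 , h²≤d , d≤4h²) = scaled (suc h-1) h²≤d d≤4h²

theorem1 : ∃[ c₁ ] ∃[ c₂ ] ((0ℚ < c₁) × (c₁ < c₂) ×
    (∀ (d : ℕ) → 2 ℕ.≤ d → HalfPlusLeGamma 2 d c₁ × GammaLeHalfPlus 2 d c₂))
theorem1 = c₁ , c₂ , toWitness {a? = 0ℚ <? c₁} _ , toWitness {a? = c₁ <? c₂} _ , bounds
  where
  bounds : ∀ d → 2 ℕ.≤ d → HalfPlusLeGamma 2 d c₁ × GammaLeHalfPlus 2 d c₂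
  bounds (suc d) _ = halfPlusLeGamma d , gammaLeHalfPlus d
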